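{- Every $3$-anti-circulant digraph is $\alpha$-diperfect.
   Context: All digraphs are finite, without loops and without multiple arcs (digons allowed). $u\to v$ means $uv$ is an arc. A path is a sequence of distinct vertices $v_1\dots v_k$ with $v_iv_{i+1}$ an arc for all $i$. A stable set is a set of pairwise non-adjacent vertices. A path partition of $D$ is a collection of vertex-disjoint paths covering $V(D)$. For a stable set $S$, an $S$-path partition is a path partition in which every path contains exactly one vertex of $S$. $D$ satisfies the $\alpha$-property if for every maximum stable set $S$ of $D$ there is an $S$-path partition; $D$ is $\alpha$-diperfect if every induced subdigraph of $D$ satisfies the $\alpha$-property. An anti-$P_4$ is a set of four distinct vertices $v_1,v_2,v_3,v_4$ with $v_1\to v_2$, $v_3\to v_2$, $v_3\to v_4$. $D$ is $3$-anti-circulant if for every anti-$P_4$ $v_1\to v_2\leftarrow v_3\to v_4$ in $D$ we have $v_4\to v_1$. -}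

module Defs where

open import Data.Nat using (ℕ; _≤_)
open import Data.Bool using (Bool; true; false)
open import Data.Fin using (Fin)
open import Data.Fin.Subset using (Subset; _∈_; _⊆_; ∣_∣)
open import Data.Fin.Subset.Properties using (_∈?_)
open import Data.List using (List; []; _∷_; concat; filter; length)
open import Data.List.Relation.Unary.All using (All)
open import Data.List.Relation.Unary.Linked using (Linked)
open import Data.List.Relation.Unary.Unique.Propositional using (Unique)
import Data.List.Membership.Propositional as LMem
open import Data.Product using (Σ; _×_; ∃)
open import Relation.Binary.PropositionalEquality using (_≡_; _≢_)
open import Relation.Nullary using (¬_)
open import Function.Bundles using (_⇔_)

-- A finite digraph: vertex set Fin n, arc relation given by a Boolean
-- adjacency function, no loops.  (Multiple arcs are impossible in this
-- representation; digons u→v, v→u are allowed.)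
record Digraph : Set where
  field
    n     : ℕ
    adj   : Fin n → Fin n → Bool
    loopless : ∀ v → adj v v ≡ false

open Digraph public

Arc : (D : Digraph) → Fin (n D) → Fin (n D) → Set
Arc D u v = adj D u v ≡ true

module _ (D : Digraph) where

  V : Set
  V = Fin (n D)

  -- Induced subdigraphs D[X] are represented by their vertex set X ⊆ V(D).

  IsStableIn : Subset (n D) → Subset (n D) → Set
  IsStableIn X S = S ⊆ X × (∀ u v → u ∈ S → v ∈ S → ¬ Arc D u v)

  IsMaxStableIn : Subset (n D) → Subset (n D) → Set
  IsMaxStableIn X S = IsStableIn X S × (∀ T → IsStableIn X T → ∣ T ∣ ≤ ∣ S ∣)

  -- A path of D[X]: a nonempty sequence of distinct vertices of X with
  -- consecutive arcs (arcs of D between vertices of X are arcs of D[X]).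
  IsPathIn : Subset (n D) → List V → Set
  IsPathIn X p = (p ≢ []) × Unique p × All (_∈ X) p × Linked (Arc D) p

  IsPathPartitionIn : Subset (n D) → List (List V) → Set
  IsPathPartitionIn X P =
    All (IsPathIn X) P × Unique (concat P) ×
    (∀ v → (v ∈ X) ⇔ (v LMem.∈ concat P))

  countIn : Subset (n D) → List V → ℕ
  countIn S p = length (filter (_∈? S) p)

  IsSPathPartitionIn : Subset (n D) → Subset (n D) → List (List V) → Set
  IsSPathPartitionIn X S P = IsPathPartitionIn X P × All (λ p → countIn S p ≡ 1) P

  AlphaPropertyIn : Subset (n D) → Set
  AlphaPropertyIn X = ∀ S → IsMaxStableIn X S → ∃ λ P → IsSPathPartitionIn X S P

AlphaDiperfect : Digraph → Set
AlphaDiperfect D = ∀ (X : Subset (n D)) → AlphaPropertyIn D X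

ThreeAntiCirculant : Digraph → Set
ThreeAntiCirculant D =
  ∀ (v₁ v₂ v₃ v₄ : Fin (n D)) →
  v₁ ≢ v₂ → v₁ ≢ v₃ → v₁ ≢ v₄ → v₂ ≢ v₃ → v₂ ≢ v₄ → v₃ ≢ v₄ →
  Arc D v₁ v₂ → Arc D v₃ v₂ → Arc D v₃ v₄ → Arc D v₄ v₁

{-# OPTIONS --safe #-}
-- Let S be a maximum stable set.  By 3-anti-circulance each in- or out-neighbourhood (a "port" of
-- its centre) is either stable or semicomplete.  A path of the form "ham. path in N⁻(s), s, ham. path
-- in N⁺(s)" can absorb any number of vertices at a semicomplete port, but only one at a stable port.
-- So only the vertices all of whose ports at S are stable ("core" vertices) have to be distributed
-- injectively.  Besides the ports they get one more kind of slot: x may follow b, on a path s b x,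
-- when b → x, b has no arc to S and x has one; then b itself is necessarily placed after some s.
--
-- An injective distribution exists by Hall's theorem.  For a minimal set Y violating Hall's condition
-- every used port has two vertices of Y, and maximality of S gives every stable Z ⊆ Y at least ∣Z∣
-- neighbours in S.  If Y has an arc b → x with b → s and x → t (or, dually, s → b and t → x), then the
-- vertices of Y at the four ports of s and t form a 4-cycle and can be removed; arcs b → x with b → s,
-- t → x are impossible.  Every other arc starts in P, the set of vertices of Y without arcs to S that
-- have an out-neighbour in Y.  Hence Y ─ P is stable and uses ∣Y ─ P∣ ports, while each vertex of P
-- provides a slot after itself, so that Y does not violate Hall's condition.
module Submission where

open import Defs
open import Data.Bool using (true; if_then_else_)
import Data.Bool.Properties as Bool
open import Data.Empty using (⊥-elim)
open import Data.Fin using (Fin; zero; suc; _≟_; splitAt; join)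
open import Data.Fin.Properties using (any?; all?; suc-injective; splitAt-join; join-splitAt)
open import Data.Fin.Subset
open import Data.Fin.Subset.Properties
open import Data.List using (List; []; _∷_; _++_; length; map; filter; allFin; concat)
import Data.List.Membership.DecPropositional as DecL
import Data.List.Membership.Propositional as L
open import Data.List.Membership.Propositional.Properties
  using (∈-filter⁺; ∈-filter⁻; ∈-allFin; ∈-map⁺; ∈-map⁻; ∈-concat⁺′; ∈-concat⁻′; ∈-++⁺ˡ; ∈-++⁺ʳ; ∈-++⁻)
open import Data.List.Properties using (length-map; filter-++; filter-none; filter-accept)
open import Data.List.Relation.Binary.Permutation.Propositional
  using (_↭_; ↭-refl; ↭-sym; ↭-trans; ↭⇒↭ₛ; prep; swap)
open import Data.List.Relation.Binary.Permutation.Propositional.Properties using (∈-resp-↭; All-resp-↭)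
import Data.List.Relation.Binary.Permutation.Setoid.Properties as Permutationₛ
open import Data.List.Relation.Unary.All as All using (All; []; _∷_)
import Data.List.Relation.Unary.All.Properties as All
open import Data.List.Relation.Unary.AllPairs as AllPairs using (AllPairs; []; _∷_)
import Data.List.Relation.Unary.AllPairs.Properties as AllPairs
open import Data.List.Relation.Unary.Any as Any using (Any; here; there)
open import Data.List.Relation.Unary.Linked using (Linked; []; [-]; _∷_)
open import Data.List.Relation.Unary.Unique.Propositional using (Unique)
import Data.List.Relation.Unary.Unique.Propositional.Properties as Unique
open import Data.Nat using (ℕ; zero; suc; _+_; _≤_; _<_; z≤n; s≤s)
open import Data.Nat.Properties hiding (_≟_; suc-injective)
open import Data.Product using (_×_; _,_; proj₁; proj₂; ∃)
open import Data.Sum as Sum using (_⊎_; inj₁; inj₂; map₂)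
open import Data.Sum.Properties using (≡-dec)
open import Data.Vec using ([]; _∷_; tabulate; here; there)
open import Data.Vec.Properties using (lookup⇒[]=; []=⇒lookup; lookup∘tabulate)
open import Function using (_∘_; _∋_; flip)
open import Function.Bundles using (mk⇔)
open import Relation.Binary.Definitions using (DecidableEquality)
open import Relation.Binary.PropositionalEquality hiding ([_])
open import Relation.Nullary using (¬_; Dec; yes; no; does; contradiction)
open import Relation.Nullary.Decidable using (_×-dec_; _⊎-dec_; _→-dec_; ¬?; dec-true)

-- Cardinalities of subsets of a finite set

private variable
  m k : ℕ

module _ {P : Fin k → Set} (P? : ∀ x → Dec (P x)) where

  select : Subset k
  select = tabulate (does ∘ P?)

  ∈-select⁺ : ∀ {x} → P x → x ∈ select
  ∈-select⁺ {x} px = lookup⇒[]= x _ (trans (lookup∘tabulate _ x) (dec-true (P? x) px))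

  ∈-select⁻ : ∀ {x} → x ∈ select → P x
  ∈-select⁻ {x} x∈ with P? x | trans (sym (lookup∘tabulate (does ∘ P?) x)) ([]=⇒lookup x∈)
  ... | yes px | _ = px
  ... | no _   | ()

x∈p─q⇒x∉q : ∀ (p q : Subset k) {x} → x ∈ p ─ q → x ∉ q
x∈p─q⇒x∉q (_ ∷ p) (_ ∷ q) (there x∈) (there x∈q) = x∈p─q⇒x∉q p q x∈ x∈q
x∈p─q⇒x∉q (_ ∷ p) (inside ∷ q) () here

∣p∪q∣≤∣p∣+∣q∣ : ∀ (p q : Subset k) → ∣ p ∪ q ∣ ≤ ∣ p ∣ + ∣ q ∣
∣p∪q∣≤∣p∣+∣q∣ [] [] = z≤n
∣p∪q∣≤∣p∣+∣q∣ (outside ∷ p) (outside ∷ q) = ∣p∪q∣≤∣p∣+∣q∣ p q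
∣p∪q∣≤∣p∣+∣q∣ (outside ∷ p) (inside ∷ q) rewrite +-suc ∣ p ∣ ∣ q ∣ = s≤s (∣p∪q∣≤∣p∣+∣q∣ p q)
∣p∪q∣≤∣p∣+∣q∣ (inside ∷ p) (outside ∷ q) = s≤s (∣p∪q∣≤∣p∣+∣q∣ p q)
∣p∪q∣≤∣p∣+∣q∣ (inside ∷ p) (inside ∷ q) =
  s≤s (≤-trans (∣p∪q∣≤∣p∣+∣q∣ p q) (+-monoʳ-≤ ∣ p ∣ (n≤1+n _)))

disjoint⇒∣p∣+∣q∣≤∣p∪q∣ : ∀ (p q : Subset k) → (∀ {x} → x ∈ p → x ∉ q) → ∣ p ∣ + ∣ q ∣ ≤ ∣ p ∪ q ∣
disjoint⇒∣p∣+∣q∣≤∣p∪q∣ [] [] _ = z≤n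
disjoint⇒∣p∣+∣q∣≤∣p∪q∣ (outside ∷ p) (outside ∷ q) d =
  disjoint⇒∣p∣+∣q∣≤∣p∪q∣ p q λ x∈p x∈q → d (there x∈p) (there x∈q)
disjoint⇒∣p∣+∣q∣≤∣p∪q∣ (outside ∷ p) (inside ∷ q) d rewrite +-suc ∣ p ∣ ∣ q ∣ =
  s≤s (disjoint⇒∣p∣+∣q∣≤∣p∪q∣ p q λ x∈p x∈q → d (there x∈p) (there x∈q))
disjoint⇒∣p∣+∣q∣≤∣p∪q∣ (inside ∷ p) (outside ∷ q) d =
  s≤s (disjoint⇒∣p∣+∣q∣≤∣p∪q∣ p q λ x∈p x∈q → d (there x∈p) (there x∈q))
disjoint⇒∣p∣+∣q∣≤∣p∪q∣ (inside ∷ p) (inside ∷ q) d = contradiction here (d here)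

x∈p⇒0<∣p∣ : ∀ {p : Subset k} {x} → x ∈ p → 0 < ∣ p ∣
x∈p⇒0<∣p∣ x∈p = ≤-trans (s≤s z≤n) (x∈p⇒∣p-x∣<∣p∣ x∈p)

0<∣p∣⇒Nonempty : ∀ (p : Subset k) → 0 < ∣ p ∣ → Nonempty p
0<∣p∣⇒Nonempty {k} p 0<∣p∣ with nonempty? p
... | yes ne = ne
... | no empty = contradiction (trans (cong ∣_∣ (Empty-unique empty)) (∣⊥∣≡0 k)) (>⇒≢ 0<∣p∣)

∣p∣≤1+∣p-x∣ : ∀ (p : Subset k) x → ∣ p ∣ ≤ suc ∣ p - x ∣
∣p∣≤1+∣p-x∣ p x = begin
  ∣ p ∣                      ≤⟨ p⊆q⇒∣p∣≤∣q∣ cover ⟩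
  ∣ ⁅ x ⁆ ∪ (p - x) ∣        ≤⟨ ∣p∪q∣≤∣p∣+∣q∣ ⁅ x ⁆ (p - x) ⟩
  ∣ ⁅ x ⁆ ∣ + ∣ p - x ∣      ≡⟨ cong (_+ ∣ p - x ∣) (∣⁅x⁆∣≡1 x) ⟩
  suc ∣ p - x ∣              ∎
  where
  open ≤-Reasoning
  cover : p ⊆ ⁅ x ⁆ ∪ (p - x)
  cover {y} y∈p with y ≟ x
  ... | yes refl = x∈p∪q⁺ (inj₁ (x∈⁅x⁆ x))
  ... | no y≢x   = x∈p∪q⁺ (inj₂ (x∈p∧x≢y⇒x∈p-y y∈p y≢x))

∣p∣≤∣q∣+length : ∀ xs {p q : Subset k} → (∀ {x} → x ∈ p → x L.∉ xs → x ∈ q) → ∣ p ∣ ≤ ∣ q ∣ + length xs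
∣p∣≤∣q∣+length [] {p} {q} cover =
  subst (∣ p ∣ ≤_) (sym (+-identityʳ ∣ q ∣)) (p⊆q⇒∣p∣≤∣q∣ λ x∈p → cover x∈p λ ())
∣p∣≤∣q∣+length (y ∷ xs) {p} {q} cover = begin
  ∣ p ∣                        ≤⟨ ∣p∣≤1+∣p-x∣ p y ⟩
  suc ∣ p - y ∣                ≤⟨ s≤s (∣p∣≤∣q∣+length xs cover′) ⟩
  suc (∣ q ∣ + length xs)      ≡⟨ sym (+-suc ∣ q ∣ _) ⟩
  ∣ q ∣ + suc (length xs)      ∎
  where
  open ≤-Reasoning
  cover′ : ∀ {x} → x ∈ p - y → x L.∉ xs → x ∈ q
  cover′ {x} x∈ x∉xs = cover (p─q⊆p p _ x∈) λ
    { (here refl) → x∈p─q⇒x∉q p ⁅ y ⁆ x∈ (x∈⁅x⁆ y)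
    ; (there x∈xs) → x∉xs x∈xs }

∣q∣+length≤∣p∣ : ∀ {xs} {p q : Subset k} → Unique xs → q ⊆ p → All (_∈ p) xs → All (_∉ q) xs →
                 ∣ q ∣ + length xs ≤ ∣ p ∣
∣q∣+length≤∣p∣ {q = q} [] q⊆p [] [] = subst (_≤ _) (sym (+-identityʳ ∣ q ∣)) (p⊆q⇒∣p∣≤∣q∣ q⊆p)
∣q∣+length≤∣p∣ {xs = y ∷ xs} {p} {q} (y∉xs ∷ uxs) q⊆p (y∈p ∷ xs∈p) (y∉q ∷ xs∉q) = begin
  ∣ q ∣ + suc (length xs)      ≡⟨ +-suc ∣ q ∣ _ ⟩
  suc (∣ q ∣ + length xs)      ≤⟨ s≤s (∣q∣+length≤∣p∣ uxs q⊆p-y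
                                   (All.zipWith (λ (x∈p , y≢x) → x∈p∧x≢y⇒x∈p-y x∈p (y≢x ∘ sym))
                                     (xs∈p , y∉xs)) xs∉q) ⟩
  suc ∣ p - y ∣                ≤⟨ x∈p⇒∣p-x∣<∣p∣ y∈p ⟩
  ∣ p ∣                        ∎
  where
  open ≤-Reasoning
  q⊆p-y : q ⊆ p - y
  q⊆p-y x∈q = x∈p∧x≢y⇒x∈p-y (q⊆p x∈q) λ { refl → y∉q x∈q }

∣∣-mono-injection : ∀ {p : Subset m} {q : Subset k} (f : Fin m → Fin k) →
                    (∀ {x} → x ∈ p → f x ∈ q) →
                    (∀ {x y} → x ∈ p → y ∈ p → f x ≡ f y → x ≡ y) → ∣ p ∣ ≤ ∣ q ∣
∣∣-mono-injection {p = []} f into inj = z≤n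
∣∣-mono-injection {p = outside ∷ p} f into inj =
  ∣∣-mono-injection (f ∘ suc) (into ∘ there)
    λ x∈ y∈ eq → suc-injective (inj (there x∈) (there y∈) eq)
∣∣-mono-injection {p = inside ∷ p} {q} f into inj =
  ≤-trans (s≤s (∣∣-mono-injection {p = p} {q - f zero} (f ∘ suc)
    (λ x∈ → x∈p∧x≢y⇒x∈p-y (into (there x∈)) λ eq → 0≢suc (inj here (there x∈) (sym eq)))
    (λ x∈ y∈ eq → suc-injective (inj (there x∈) (there y∈) eq))))
    (x∈p⇒∣p-x∣<∣p∣ (into here))
  where
  0≢suc : ∀ {x : Fin k} → zero ≢ suc x
  0≢suc ()

-- Hall's marriage theorem

module Marriage {m k} {R : Fin m → Fin k → Set} (R? : ∀ a q → Dec (R a q)) where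

  neighbour? : ∀ C W q → Dec (q ∈ C × ∃ λ a → a ∈ W × R a q)
  neighbour? C W q = q ∈? C ×-dec any? λ a → a ∈? W ×-dec R? a q

  neighbours : Subset k → Subset m → Subset k
  neighbours C W = select (neighbour? C W)

  ∈-neighbours⁺ : ∀ {C W a q} → q ∈ C → a ∈ W → R a q → q ∈ neighbours C W
  ∈-neighbours⁺ {C} {W} q∈C a∈W r = ∈-select⁺ (neighbour? C W) (q∈C , _ , a∈W , r)

  ∈-neighbours⁻ : ∀ {C W q} → q ∈ neighbours C W → q ∈ C × ∃ λ a → a ∈ W × R a q
  ∈-neighbours⁻ {C} {W} = ∈-select⁻ (neighbour? C W)

  HallCondition : Subset m → Subset k → Set
  HallCondition A C = ∀ W → W ⊆ A → ∣ W ∣ ≤ ∣ neighbours C W ∣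

  Matching : Subset m → Subset k → Set
  Matching A C = ∃ λ (f : Fin m → Fin k) →
    (∀ {a} → a ∈ A → f a ∈ C × R a (f a)) × (∀ {a b} → a ∈ A → b ∈ A → f a ≡ f b → a ≡ b)

  -- Of the neighbours of `W ∪ T` at most `∣ T ∣` lie in `neighbours C T`. Hall's condition for
  -- `W ∪ T`, with `∣ T ∣` cancelled, therefore leaves enough neighbours of `W` outside.
  tight-remainder : ∀ {A C T} → HallCondition A C → T ⊆ A → ∣ neighbours C T ∣ ≤ ∣ T ∣ →
                    HallCondition (A ─ T) (C ─ neighbours C T)
  tight-remainder {A} {C} {T} hall T⊆A tight W W⊆A─T = +-cancelʳ-≤ ∣ T ∣ _ _ (begin
    ∣ W ∣ + ∣ T ∣              ≤⟨ disjoint⇒∣p∣+∣q∣≤∣p∪q∣ W T (x∈p─q⇒x∉q A T ∘ W⊆A─T) ⟩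
    ∣ W ∪ T ∣                  ≤⟨ hall (W ∪ T) W∪T⊆A ⟩
    ∣ neighbours C (W ∪ T) ∣   ≤⟨ p⊆q⇒∣p∣≤∣q∣ split ⟩
    ∣ N′ ∪ neighbours C T ∣    ≤⟨ ∣p∪q∣≤∣p∣+∣q∣ N′ _ ⟩
    ∣ N′ ∣ + ∣ neighbours C T ∣ ≤⟨ +-monoʳ-≤ ∣ N′ ∣ tight ⟩
    ∣ N′ ∣ + ∣ T ∣             ∎)
    where
    open ≤-Reasoning
    N′ = neighbours (C ─ neighbours C T) W
    W∪T⊆A : W ∪ T ⊆ A
    W∪T⊆A x∈ with x∈p∪q⁻ W T x∈
    ... | inj₁ x∈W = p─q⊆p A T (W⊆A─T x∈W)
    ... | inj₂ x∈T = T⊆A x∈T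
    split : neighbours C (W ∪ T) ⊆ N′ ∪ neighbours C T
    split {q} q∈ with q ∈? neighbours C T | ∈-neighbours⁻ q∈
    ... | yes q∈NT | _ = x∈p∪q⁺ (inj₂ q∈NT)
    ... | no q∉NT | q∈C , a , a∈ , r with x∈p∪q⁻ W T a∈
    ...   | inj₁ a∈W = x∈p∪q⁺ (inj₁ (∈-neighbours⁺ (x∈p∧x∉q⇒x∈p─q q∈C q∉NT) a∈W r))
    ...   | inj₂ a∈T = contradiction (∈-neighbours⁺ q∈C a∈T r) q∉NT

  -- Without a tight proper nonempty subset, every nonempty `W` avoiding `a` has a neighbour to
  -- spare, and deleting `q` costs at most one.
  surplus-remainder : ∀ {A C a} q → a ∈ A →
    ¬ (∃ λ T → T ⊆ A × Nonempty T × ∣ T ∣ < ∣ A ∣ × ∣ neighbours C T ∣ ≤ ∣ T ∣) →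
    HallCondition (A - a) (C - q)
  surplus-remainder {A} {C} {a} q a∈A surplus W W⊆ with nonempty? W
  ... | no empty = ≤-trans (≤-reflexive (trans (cong ∣_∣ (Empty-unique empty)) (∣⊥∣≡0 m))) z≤n
  ... | yes ne = ≤-pred (begin
    suc ∣ W ∣                        ≤⟨ ≰⇒> (λ tight → surplus (W , p─q⊆p A _ ∘ W⊆ , ne ,
                                          ≤-<-trans (p⊆q⇒∣p∣≤∣q∣ W⊆) (x∈p⇒∣p-x∣<∣p∣ a∈A) , tight)) ⟩
    ∣ neighbours C W ∣               ≤⟨ ∣p∣≤1+∣p-x∣ (neighbours C W) q ⟩
    suc ∣ neighbours C W - q ∣       ≤⟨ s≤s (p⊆q⇒∣p∣≤∣q∣ sub) ⟩
    suc ∣ neighbours (C - q) W ∣     ∎)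
    where
    open ≤-Reasoning
    sub : neighbours C W - q ⊆ neighbours (C - q) W
    sub {y} y∈ with ∈-neighbours⁻ (p─q⊆p (neighbours C W) _ y∈)
    ... | y∈C , b , b∈W , r =
      ∈-neighbours⁺ (x∈p∧x≢y⇒x∈p-y y∈C λ { refl → x∈p─q⇒x∉q (neighbours C W) _ y∈ (x∈⁅x⁆ q) }) b∈W r

  -- The images are disjoint: on `T` the values lie in `neighbours C T`, which the other matching
  -- avoids.
  union-matching : ∀ {A C T} → T ⊆ A → Matching T C → Matching (A ─ T) (C ─ neighbours C T) →
                   Matching A C
  union-matching {A} {C} {T} T⊆A (f , f-ok , f-inj) (g , g-ok , g-inj) = h , h-ok , h-inj
    where
    h : Fin m → Fin k
    h a = if does (a ∈? T) then f a else g a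
    g-sep : ∀ {a b} → a ∈ T → b ∈ A ─ T → f a ≢ g b
    g-sep a∈T b∈ eq = x∈p─q⇒x∉q C _ (proj₁ (g-ok b∈))
      (subst (_∈ neighbours C T) eq (∈-neighbours⁺ (proj₁ (f-ok a∈T)) a∈T (proj₂ (f-ok a∈T))))
    h-ok : ∀ {a} → a ∈ A → h a ∈ C × R a (h a)
    h-ok {a} a∈A with a ∈? T
    ... | yes a∈T = f-ok a∈T
    ... | no a∉T with g-ok (x∈p∧x∉q⇒x∈p─q a∈A a∉T)
    ...   | ga∈ , r = p─q⊆p C _ ga∈ , r
    h-inj : ∀ {a b} → a ∈ A → b ∈ A → h a ≡ h b → a ≡ b
    h-inj {a} {b} a∈A b∈A eq with a ∈? T | b ∈? T
    ... | yes a∈T | yes b∈T = f-inj a∈T b∈T eq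
    ... | yes a∈T | no b∉T = ⊥-elim (g-sep a∈T (x∈p∧x∉q⇒x∈p─q b∈A b∉T) eq)
    ... | no a∉T | yes b∈T = ⊥-elim (g-sep b∈T (x∈p∧x∉q⇒x∈p─q a∈A a∉T) (sym eq))
    ... | no a∉T | no b∉T = g-inj (x∈p∧x∉q⇒x∈p─q a∈A a∉T) (x∈p∧x∉q⇒x∈p─q b∈A b∉T) eq

  extend-matching : ∀ {A C a q} → q ∈ C → R a q → Matching (A - a) (C - q) → Matching A C
  extend-matching {A} {C} {a} {q} q∈C r (g , g-ok , g-inj) = h , h-ok , h-inj
    where
    h : Fin m → Fin k
    h b = if does (b ≟ a) then q else g b
    g-sep : ∀ {b} → b ∈ A - a → q ≢ g b
    g-sep b∈ refl = x∈p─q⇒x∉q C _ (proj₁ (g-ok b∈)) (x∈⁅x⁆ q)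
    h-ok : ∀ {b} → b ∈ A → h b ∈ C × R b (h b)
    h-ok {b} b∈A with b ≟ a
    ... | yes refl = q∈C , r
    ... | no b≢a with g-ok (x∈p∧x≢y⇒x∈p-y b∈A b≢a)
    ...   | gb∈ , r′ = p─q⊆p C _ gb∈ , r′
    h-inj : ∀ {b c} → b ∈ A → c ∈ A → h b ≡ h c → b ≡ c
    h-inj {b} {c} b∈A c∈A eq with b ≟ a | c ≟ a
    ... | yes refl | yes refl = refl
    ... | yes refl | no c≢a = ⊥-elim (g-sep (x∈p∧x≢y⇒x∈p-y c∈A c≢a) eq)
    ... | no b≢a | yes refl = ⊥-elim (g-sep (x∈p∧x≢y⇒x∈p-y b∈A b≢a) (sym eq))
    ... | no b≢a | no c≢a = g-inj (x∈p∧x≢y⇒x∈p-y b∈A b≢a) (x∈p∧x≢y⇒x∈p-y c∈A c≢a) eq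

  module _ (default : Fin m → Fin k) where

    -- The induction of Halmos and Vaughan: a tight proper subset splits the problem in two;
    -- otherwise any admissible pair can be fixed and the rest matched. The bound `j` makes the
    -- recursion structural, and `default` supplies a total function once `A` is empty.
    hall-bounded : ∀ j A C → ∣ A ∣ ≤ j → HallCondition A C → Matching A C
    hall-bounded j A C ∣A∣≤j hall with nonempty? A
    ... | no empty = default , (λ a∈A → contradiction (_ , a∈A) empty) ,
                     λ a∈A → contradiction (_ , a∈A) empty
    hall-bounded zero A C ∣A∣≤0 hall | yes (a , a∈A) = contradiction ∣A∣≤0 (<⇒≱ (x∈p⇒0<∣p∣ a∈A))
    hall-bounded (suc j) A C ∣A∣≤1+j hall | yes (a , a∈A)
      with anySubset? (λ T → T ⊆? A ×-dec nonempty? T ×-dec ∣ T ∣ <? ∣ A ∣ ×-dec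
                            ∣ neighbours C T ∣ ≤? ∣ T ∣)
    ... | yes (T , T⊆A , (t , t∈T) , ∣T∣<∣A∣ , tight) =
      union-matching T⊆A
        (hall-bounded j T C (≤-pred (≤-trans ∣T∣<∣A∣ ∣A∣≤1+j)) λ W W⊆T → hall W (T⊆A ∘ W⊆T))
        (hall-bounded j (A ─ T) (C ─ neighbours C T)
          (≤-pred (≤-trans (p∩q≢∅⇒∣p─q∣<∣p∣ A T (t , x∈p∩q⁺ (T⊆A t∈T , t∈T))) ∣A∣≤1+j))
          (tight-remainder hall T⊆A tight))
    ... | no surplus
      with 0<∣p∣⇒Nonempty (neighbours C ⁅ a ⁆)
             (≤-trans (≤-reflexive (sym (∣⁅x⁆∣≡1 a)))
               (hall ⁅ a ⁆ λ x∈ → subst (_∈ A) (sym (x∈⁅y⁆⇒x≡y a x∈)) a∈A))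
    ...   | q , q∈ with ∈-neighbours⁻ q∈
    ...     | q∈C , b , b∈ , r with x∈⁅y⁆⇒x≡y a b∈
    ...       | refl = extend-matching q∈C r
      (hall-bounded j (A - a) (C - q) (≤-pred (≤-trans (x∈p⇒∣p-x∣<∣p∣ a∈A) ∣A∣≤1+j))
        (surplus-remainder q a∈A surplus))

    hall : ∀ A C → HallCondition A C → Matching A C
    hall A C = hall-bounded ∣ A ∣ A C ≤-refl

-- Arcs between vertices with independent ports

module _ {V : Set} where

  Adjacent : (V → V → Set) → V → V → Set
  Adjacent E u v = E u v ⊎ E v u

  -- The inequalities concern the three pairs that no assumed arc joins. For the joined pairs
  -- distinctness comes from looplessness.
  AntiCirculant : (V → V → Set) → Set
  AntiCirculant E = ∀ {v₁ v₂ v₃ v₄} → v₁ ≢ v₃ → v₁ ≢ v₄ → v₂ ≢ v₄ →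
                    E v₁ v₂ → E v₃ v₂ → E v₃ v₄ → E v₄ v₁

  -- An anti-$P_4$ of the reversed relation is an anti-$P_4$ of `E` read from its other end. Hence
  -- every statement about in-ports has a dual about out-ports.
  AntiCirculant-flip : ∀ {E} → AntiCirculant E → AntiCirculant (flip E)
  AntiCirculant-flip ac v₁≢v₃ v₁≢v₄ v₂≢v₄ e₁ e₂ e₃ = ac (≢-sym v₂≢v₄) (≢-sym v₁≢v₄) (≢-sym v₁≢v₃) e₃ e₂ e₁

  -- What the local analysis uses of a minimal set `Y` violating Hall's condition: ports are stable
  -- (`in-indep`, `out-indep`), by minimality no port holds a single vertex of `Y` (`in-other`,
  -- `out-other`), and `escape` is the maximality of `S`. The relation is arbitrary so that it can
  -- be reversed.
  record Configuration (E : V → V → Set) (S Y : V → Set) : Set where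
    field
      anti      : AntiCirculant E
      S-stable  : ∀ {s t} → S s → S t → ¬ E s t
      Y≢S       : ∀ {y s} → Y y → S s → y ≢ s
      in-indep  : ∀ {s y z} → S s → Y y → Y z → E y s → E z s → ¬ E y z
      out-indep : ∀ {s y z} → S s → Y y → Y z → E s y → E s z → ¬ E y z
      in-other  : ∀ {s y} → S s → Y y → E y s → ∃ λ z → Y z × z ≢ y × E z s
      out-other : ∀ {s y} → S s → Y y → E s y → ∃ λ z → Y z × z ≢ y × E s z
      escape    : ∀ {zs} ss → Unique zs → All Y zs → AllPairs (λ y z → ¬ Adjacent E y z) zs →
                  length ss < length zs → ∃ λ u → S u × u L.∉ ss × Any (Adjacent E u) zs

  Configuration-flip : ∀ {E S Y} → Configuration E S Y → Configuration (flip E) S Y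
  Configuration-flip c = record
    { anti = λ {v₁} → AntiCirculant-flip anti {v₁}
    ; S-stable = λ s t → S-stable t s
    ; Y≢S = Y≢S
    ; in-indep = λ Ss Yy Yz e f → out-indep Ss Yz Yy f e
    ; out-indep = λ Ss Yy Yz e f → in-indep Ss Yz Yy f e
    ; in-other = out-other
    ; out-other = in-other
    ; escape = λ ss uzs Yzs indep lt → let u , Su , u∉ss , any = escape ss uzs Yzs (AllPairs.map (_∘ Sum.swap) indep) lt
                                       in u , Su , u∉ss , Any.map Sum.swap any
    }
    where open Configuration c

  -- A part of Y with at most four elements that uses up four ports.
  record ClosedQuadruple (E : V → V → Set) (S Y : V → Set) : Set where
    field
      {b x b′ x′ s t} : V
      Ss  : S s
      St  : S t
      s≢t : s ≢ t
      Yb  : Y b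
      in-s  : ∃ λ y → Y y × E y s
      in-t  : ∃ λ y → Y y × E y t
      out-s : ∃ λ y → Y y × E s y
      out-t : ∃ λ y → Y y × E t y
      closed : ∀ {y} → Y y → Adjacent E y s ⊎ Adjacent E y t → y L.∈ b ∷ x ∷ b′ ∷ x′ ∷ []

  ClosedQuadruple-flip : ∀ {E S Y} → ClosedQuadruple E S Y → ClosedQuadruple (flip E) S Y
  ClosedQuadruple-flip c = record
    { Ss = Ss ; St = St ; s≢t = s≢t ; Yb = Yb
    ; in-s = out-s ; in-t = out-t ; out-s = in-s ; out-t = in-t
    ; closed = λ Yy → closed Yy ∘ Sum.map Sum.swap Sum.swap }
    where open ClosedQuadruple c

  module Local {E : V → V → Set} {S Y : V → Set} (_≟_ : DecidableEquality V)
               (c : Configuration E S Y) where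
    open Configuration c

    -- Two non-adjacent vertices of `Y` have at least two neighbours in `S` between them, hence one
    -- besides `s`.
    pair-escape : ∀ {y z} s → Y y → Y z → y ≢ z → ¬ E y z → ¬ E z y →
                  ∃ λ u → S u × u ≢ s × (Adjacent E u y ⊎ Adjacent E u z)
    pair-escape s Yy Yz y≢z ¬yz ¬zy
      with escape (s ∷ []) ((y≢z ∷ []) ∷ [] ∷ []) (Yy ∷ Yz ∷ [])
             ((Sum.[ ¬yz , ¬zy ] ∷ []) ∷ [] ∷ []) (s≤s (s≤s z≤n))
    ... | u , Su , u∉ , here a = u , Su , u∉ ∘ here , inj₁ a
    ... | u , Su , u∉ , there (here a) = u , Su , u∉ ∘ here , inj₂ a

    -- A directed 4-cycle `b x b′ x′` whose opposite vertices share an in-port, that of `s` or that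
    -- of `t`.
    record Quad (b x b′ x′ s t : V) : Set where
      field
        Yb  : Y b
        Yx  : Y x
        Yb′ : Y b′
        Yx′ : Y x′
        Ss  : S s
        St  : S t
        b≢b′ : b ≢ b′
        x≢x′ : x ≢ x′
        bx   : E b x
        xb′  : E x b′
        b′x′ : E b′ x′
        x′b  : E x′ b
        bs   : E b s
        b′s  : E b′ s
        xt   : E x t
        x′t  : E x′ t

    -- One step along the cycle exchanges `s` and `t`; two steps exchange `b` with `b′` and `x` with
    -- `x′`. So it suffices to study the vertex `b`.
    rotate : ∀ {b x b′ x′ s t} → Quad b x b′ x′ s t → Quad x b′ x′ b t s
    rotate q = record
      { Yb = Yx ; Yx = Yb′ ; Yb′ = Yx′ ; Yx′ = Yb ; Ss = St ; St = Ss
      ; b≢b′ = x≢x′ ; x≢x′ = ≢-sym b≢b′ ; bx = xb′ ; xb′ = b′x′ ; b′x′ = x′b ; x′b = bx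
      ; bs = xt ; b′s = x′t ; xt = b′s ; x′t = bs }
      where open Quad q

    -- The missing arcs come in turn from `b′ → s ← b → x`, `x′ → t ← x → b′` and `b → s ← b′ → x′`.
    -- Stability of the in-ports rules out coincidences of their end vertices.
    mkQuad : ∀ {b x b′ x′ s t} → Y b → Y x → Y b′ → Y x′ → S s → S t → b′ ≢ b → x′ ≢ x →
             E b x → E b s → E b′ s → E x t → E x′ t → Quad b x b′ x′ s t
    mkQuad {b} {x} {b′} {x′} {s} {t} Yb Yx Yb′ Yx′ Ss St b′≢b x′≢x bx bs b′s xt x′t = record
      { Yb = Yb ; Yx = Yx ; Yb′ = Yb′ ; Yx′ = Yx′ ; Ss = Ss ; St = St
      ; b≢b′ = ≢-sym b′≢b ; x≢x′ = ≢-sym x′≢x ; bx = bx ; xb′ = xb′ ; b′x′ = b′x′ ; x′b = x′b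
      ; bs = bs ; b′s = b′s ; xt = xt ; x′t = x′t }
      where
      xb′ : E x b′
      xb′ = anti b′≢b (λ { refl → in-indep Ss Yb Yx bs b′s bx }) (≢-sym (Y≢S Yx Ss)) b′s bs bx
      b′x′ : E b′ x′
      b′x′ = anti x′≢x (λ { refl → in-indep St Yx Yb′ xt x′t xb′ }) (≢-sym (Y≢S Yb′ St)) x′t xt xb′
      x′b : E x′ b
      x′b = anti (≢-sym b′≢b) (λ { refl → in-indep St Yb Yx x′t xt bx }) (≢-sym (Y≢S Yx′ Ss)) bs b′s b′x′

    module _ {b x b′ x′ s t} (q : Quad b x b′ x′ s t) where
      open Quad q

      -- For `u ≡ t` the arc `b → x` would lie inside the in-port of `t`. For a third `u`,
      -- `b′ → s ← b → u` gives `u → b′`, and then `u → b′ ← x → t` gives an arc `t → u` inside `S`.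
      quad-out : ∀ {u} → S u → E b u → u ≡ s
      quad-out {u} Su bu with u ≟ s
      ... | yes u≡s = u≡s
      ... | no u≢s with u ≟ t
      ...   | yes refl = contradiction bx (in-indep St Yb Yx bu xt)
      ...   | no u≢t = contradiction
        (anti (≢-sym (Y≢S Yx Su)) u≢t (Y≢S Yb′ St)
          (anti (≢-sym b≢b′) (Y≢S Yb′ Su) (≢-sym u≢s) b′s bs bu) xb′ xt)
        (S-stable St Su)

      -- For `u ≢ t`, `u → b ← x′ → t` would give an arc `t → u` inside `S`.
      quad-in : ∀ {u} → S u → E u b → u ≡ t
      quad-in {u} Su ub with u ≟ t
      ... | yes u≡t = u≡t
      ... | no u≢t = contradiction (anti (≢-sym (Y≢S Yx′ Su)) u≢t (Y≢S Yb St) ub x′b x′t) (S-stable St Su)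

    quad-port : ∀ {b x b′ x′ s t u} → Quad b x b′ x′ s t → S u → u ≢ s → Adjacent E u b → u ≡ t × E u b
    quad-port q Su u≢s (inj₁ ub) = quad-in q Su ub , ub
    quad-port q Su u≢s (inj₂ bu) = contradiction (quad-out q Su bu) u≢s

    -- The stable pair `b`, `b′` has a neighbour in `S` other than `s`, and `quad-port` leaves only
    -- `t`, with its arc directed towards the pair.
    quad-out-port : ∀ {b x b′ x′ s t} → Quad b x b′ x′ s t → E t b ⊎ E t b′
    quad-out-port {s = s} q
      with pair-escape s Yb Yb′ b≢b′ (in-indep Ss Yb Yb′ bs b′s) (in-indep Ss Yb′ Yb b′s bs)
      where open Quad q
    ... | u , Su , u≢s , inj₁ a with quad-port q Su u≢s a
    ...   | refl , tb = inj₁ tb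
    quad-out-port q | u , Su , u≢s , inj₂ a with quad-port (rotate (rotate q)) Su u≢s a
    ...   | refl , tb′ = inj₂ tb′

    -- A third vertex `y` at this port would make `b`, `b′`, `y` independent, so they would have a
    -- neighbour in `S` outside `s`, `t`. But `y` can replace `b′` in the cycle, so `quad-port`
    -- confines the neighbours of all three to `s` and `t`.
    quad-in-closed : ∀ {b x b′ x′ s t y} → Quad b x b′ x′ s t → Y y → E y s → y ≡ b ⊎ y ≡ b′
    quad-in-closed {b} {x} {b′} {x′} {s} {t} {y} q Yy ys with y ≟ b | y ≟ b′
    ... | yes y≡b | _ = inj₁ y≡b
    ... | no _ | yes y≡b′ = inj₂ y≡b′
    ... | no y≢b | no y≢b′
      with escape (s ∷ t ∷ []) ((b≢b′ ∷ ≢-sym y≢b ∷ []) ∷ (≢-sym y≢b′ ∷ []) ∷ [] ∷ [])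
             (Yb ∷ Yb′ ∷ Yy ∷ [])
             ((indep Yb Yb′ bs b′s ∷ indep Yb Yy bs ys ∷ []) ∷ (indep Yb′ Yy b′s ys ∷ []) ∷ [] ∷ [])
             (s≤s (s≤s (s≤s z≤n)))
      where
      open Quad q
      indep : ∀ {v w} → Y v → Y w → E v s → E w s → ¬ Adjacent E v w
      indep Yv Yw vs ws = Sum.[ in-indep Ss Yv Yw vs ws , in-indep Ss Yw Yv ws vs ]
    ...   | u , Su , u∉ , here a =
      contradiction (there (here (proj₁ (quad-port q Su (u∉ ∘ here) a)))) u∉
    ...   | u , Su , u∉ , there (here a) =
      contradiction (there (here (proj₁ (quad-port (rotate (rotate q)) Su (u∉ ∘ here) a)))) u∉
    ...   | u , Su , u∉ , there (there (here a)) =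
      contradiction (there (here (proj₁ (quad-port (rotate (rotate q′)) Su (u∉ ∘ here) a)))) u∉
      where
      open Quad q
      q′ : Quad b x y x′ s t
      q′ = mkQuad Yb Yx Yy Yx′ Ss St y≢b (≢-sym x≢x′) bx bs ys xt x′t

    -- For another `y`, `x′ → b ← t → y` gives `y → x′`, and then `y → x′ ← b′ → s` gives `s → y`.
    -- By `quad-out-port` also `s → x` or `s → x′`. The former yields `y → b` inside the out-port of
    -- `t`, the latter puts `y → x′` inside the out-port of `s`.
    quad-out-closed′ : ∀ {b x b′ x′ s t y} → Quad b x b′ x′ s t → E t b → Y y → E t y → y ≡ b ⊎ y ≡ b′
    quad-out-closed′ {b} {x} {b′} {x′} {s} {t} {y} q tb Yy ty with y ≟ b | y ≟ b′
    ... | yes y≡b | _ = inj₁ y≡b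
    ... | no _ | yes y≡b′ = inj₂ y≡b′
    ... | no y≢b | no y≢b′ = ⊥-elim (s-port (quad-out-port (rotate q)))
      where
      open Quad q
      y≢x : y ≢ x
      y≢x refl = out-indep St Yb Yy tb ty bx
      x′≢y : x′ ≢ y
      x′≢y refl = out-indep St Yy Yb ty tb x′b
      yx′ : E y x′
      yx′ = anti (Y≢S Yx′ St) x′≢y (≢-sym y≢b) x′b tb ty
      sy : E s y
      sy = anti y≢b′ (Y≢S Yy Ss) (Y≢S Yx′ Ss) yx′ b′x′ b′s
      s-port : ¬ (E s x ⊎ E s x′)
      s-port (inj₁ sx) = out-indep St Yy Yb ty tb
        (anti (Y≢S Yb Ss) (≢-sym y≢b) (≢-sym y≢x) bx sx sy)
      s-port (inj₂ sx′) = out-indep Ss Yy Yx′ sy sx′ yx′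

    quad-out-closed : ∀ {b x b′ x′ s t y} → Quad b x b′ x′ s t → Y y → E t y → y ≡ b ⊎ y ≡ b′
    quad-out-closed q Yy ty with quad-out-port q
    ... | inj₁ tb = quad-out-closed′ q tb Yy ty
    ... | inj₂ tb′ = Sum.swap (quad-out-closed′ (rotate (rotate q)) tb′ Yy ty)

    quad⇒closed : ∀ {b x b′ x′ s t} → Quad b x b′ x′ s t → ClosedQuadruple E S Y
    quad⇒closed {b} {x} {b′} {x′} {s} {t} q = record
      { b = b ; x = x ; b′ = b′ ; x′ = x′
      ; Ss = Ss ; St = St ; s≢t = λ { refl → in-indep Ss Yb Yx bs xt bx } ; Yb = Yb
      ; in-s = b , Yb , bs ; in-t = x , Yx , xt
      ; out-s = Sum.[ (λ sx → x , Yx , sx) , (λ sx′ → x′ , Yx′ , sx′) ] (quad-out-port (rotate q))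
      ; out-t = Sum.[ (λ tb → b , Yb , tb) , (λ tb′ → b′ , Yb′ , tb′) ] (quad-out-port q)
      ; closed = closed }
      where
      open Quad q
      bs-in : ∀ {y} → y ≡ b ⊎ y ≡ b′ → y L.∈ b ∷ x ∷ b′ ∷ x′ ∷ []
      bs-in (inj₁ eq) = here eq
      bs-in (inj₂ eq) = there (there (here eq))
      xs-in : ∀ {y} → y ≡ x ⊎ y ≡ x′ → y L.∈ b ∷ x ∷ b′ ∷ x′ ∷ []
      xs-in (inj₁ eq) = there (here eq)
      xs-in (inj₂ eq) = there (there (there (here eq)))
      closed : ∀ {y} → Y y → Adjacent E y s ⊎ Adjacent E y t → y L.∈ b ∷ x ∷ b′ ∷ x′ ∷ []
      closed Yy (inj₁ (inj₁ ys)) = bs-in (quad-in-closed q Yy ys)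
      closed Yy (inj₁ (inj₂ sy)) = xs-in (quad-out-closed (rotate q) Yy sy)
      closed Yy (inj₂ (inj₁ yt)) = xs-in (quad-in-closed (rotate q) Yy yt)
      closed Yy (inj₂ (inj₂ ty)) = bs-in (quad-out-closed q Yy ty)

    -- Neither in-port holds a single vertex of `Y`; the second ones serve as `b′` and `x′`.
    out-out⇒closed : ∀ {b x s t} → Y b → Y x → S s → S t → E b x → E b s → E x t →
                     ClosedQuadruple E S Y
    out-out⇒closed Yb Yx Ss St bx bs xt with in-other Ss Yb bs | in-other St Yx xt
    ... | b′ , Yb′ , b′≢b , b′s | x′ , Yx′ , x′≢x , x′t =
      quad⇒closed (mkQuad Yb Yx Yb′ Yx′ Ss St b′≢b x′≢x bx bs b′s xt x′t)

    -- For `t ≢ s`, `t → x ← b → s` gives an arc inside `S`. For `t ≡ s`, take a second `b′` at the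
    -- in-port of `s`; then `x → b′`. The pair `b`, `b′` has another neighbour `u` in `S`, and each
    -- possible arc at `u` leads either to an arc inside `S` or to an arc of `Y` excluded by
    -- `¬in-in`.
    ¬out-in : (∀ {b x s t} → Y b → Y x → S s → S t → E b x → E s b → ¬ E t x) →
              ∀ {b x s t} → Y b → Y x → S s → S t → E b x → E b s → ¬ E t x
    ¬out-in ¬in-in {b} {x} {s} {t} Yb Yx Ss St bx bs tx with t ≟ s
    ... | no t≢s = S-stable Ss St (anti (≢-sym (Y≢S Yb St)) t≢s (Y≢S Yx Ss) tx bx bs)
    ... | yes refl with in-other Ss Yb bs
    ...   | b′ , Yb′ , b′≢b , b′s = refute
      (pair-escape s Yb Yb′ (≢-sym b′≢b) (in-indep Ss Yb Yb′ bs b′s) (in-indep Ss Yb′ Yb b′s bs))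
      where
      xb′ : E x b′
      xb′ = anti b′≢b (λ { refl → in-indep Ss Yb Yx bs b′s bx }) (≢-sym (Y≢S Yx Ss)) b′s bs bx
      refute : ¬ ∃ λ u → S u × u ≢ s × (Adjacent E u b ⊎ Adjacent E u b′)
      refute (u , Su , u≢s , inj₁ (inj₁ ub)) = ¬in-in Yb Yx Su Ss bx ub tx
      refute (u , Su , u≢s , inj₁ (inj₂ bu)) =
        S-stable Su Ss (anti (≢-sym (Y≢S Yb Ss)) (≢-sym u≢s) (Y≢S Yx Su) tx bx bu)
      refute (u , Su , u≢s , inj₂ (inj₁ ub′)) = ¬in-in Yx Yb′ Ss Su xb′ tx ub′
      refute (u , Su , u≢s , inj₂ (inj₂ b′u)) =
        ¬in-in Yb Yx Su Ss bx (anti (≢-sym b′≢b) (Y≢S Yb Su) (≢-sym u≢s) bs b′s b′u) tx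

-- Hamiltonian paths of semicomplete digraphs

unique⇒AllPairs : ∀ {A : Set} {R : A → A → Set} {xs} → Unique xs →
                   (∀ {x y} → x L.∈ xs → y L.∈ xs → x ≢ y → R x y) → AllPairs R xs
unique⇒AllPairs [] r = []
unique⇒AllPairs (x∉xs ∷ uxs) r =
  All.tabulate (λ y∈ → r (here refl) (there y∈) (All.lookup x∉xs y∈)) ∷
  unique⇒AllPairs uxs λ x∈ y∈ → r (there x∈) (there y∈)

module _ {V : Set} {E : V → V → Set} where

  -- Invariant of the insertion: the vertex `a` just passed has an arc to `v`, so `v` may be placed
  -- right behind it.
  insert-after : ∀ {a v ys} → E a v → Linked E (a ∷ ys) → All (Adjacent E v) ys →
                 ∃ λ zs → zs ↭ v ∷ ys × Linked E (a ∷ zs)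
  insert-after av [-] [] = _ , ↭-refl , av ∷ [-]
  insert-after av (_ ∷ link) (inj₁ vy ∷ _) = _ , ↭-refl , av ∷ vy ∷ link
  insert-after {v = v} {y ∷ _} av (ay ∷ link) (inj₂ yv ∷ adjs) with insert-after yv link adjs
  ... | zs , zs↭ , link′ = y ∷ zs , ↭-trans (prep y zs↭) (swap y v ↭-refl) , ay ∷ link′

  insert : ∀ {v ys} → Linked E ys → All (Adjacent E v) ys → ∃ λ zs → zs ↭ v ∷ ys × Linked E zs
  insert [] [] = _ , ↭-refl , [-]
  insert link@([-]) (inj₁ vy ∷ _) = _ , ↭-refl , vy ∷ link
  insert link@(_ ∷ _) (inj₁ vy ∷ _) = _ , ↭-refl , vy ∷ link
  insert {v} {y ∷ _} link (inj₂ yv ∷ adjs) with insert-after yv link adjs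
  ... | zs , zs↭ , link′ = y ∷ zs , ↭-trans (prep y zs↭) (swap y v ↭-refl) , link′

  -- Rédei's theorem, by insertion of one vertex after another.
  hamiltonian-path : ∀ {xs} → AllPairs (Adjacent E) xs → ∃ λ ys → ys ↭ xs × Linked E ys
  hamiltonian-path [] = [] , ↭-refl , []
  hamiltonian-path {x ∷ _} (adjs ∷ pairs) with hamiltonian-path pairs
  ... | ys , ys↭ , link with insert link (All-resp-↭ (↭-sym ys↭) adjs)
  ...   | zs , zs↭ , link′ = zs , ↭-trans zs↭ (prep x ys↭) , link′

  Linked-∷ : ∀ {s xs} → All (E s) xs → Linked E xs → Linked E (s ∷ xs)
  Linked-∷ [] [] = [-]
  Linked-∷ (e ∷ _) link@([-]) = e ∷ link
  Linked-∷ (e ∷ _) link@(_ ∷ _) = e ∷ link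

  Linked-++-∷ : ∀ {s xs ys} → Linked E xs → All (λ x → E x s) xs → Linked E (s ∷ ys) → Linked E (xs ++ s ∷ ys)
  Linked-++-∷ [] [] link = link
  Linked-++-∷ [-] (e ∷ []) link = e ∷ link
  Linked-++-∷ (e ∷ es) (_ ∷ ins) link = e ∷ Linked-++-∷ es ins link

-- Distributing the core vertices

module _ {n} {E : Fin n → Fin n → Set} (anti : AntiCirculant E) (irrefl : ∀ {v} → ¬ E v v) where

  -- `z → s ← p → q` gives `q → z`, and then `p → s ← q → z` gives `z → p`: the three vertices form
  -- a directed triangle.
  in-third : ∀ {s p q z} → E p s → E q s → E p q → E z s → z ≢ p → z ≢ q → E q z × E z p
  in-third ps qs pq zs z≢p z≢q =
    anti z≢p z≢q (λ { refl → irrefl qs }) zs ps pq ,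
    anti (λ { refl → irrefl pq }) (≢-sym z≢p) (λ { refl → irrefl zs }) ps qs
      (anti z≢p z≢q (λ { refl → irrefl qs }) zs ps pq)

  -- One arc `p → q` in an in-neighbourhood suffices: `in-third` gives the arc `w → p`, and applied
  -- to that arc it reaches `z`.
  in-semicomplete : ∀ {s p q w z} → E p s → E q s → E p q → E w s → E z s → w ≢ z → Adjacent E w z
  in-semicomplete {s} {p} {q} {w} {z} ps qs pq ws zs w≢z with w ≟ p
  ... | yes refl with z ≟ q
  ...   | yes refl = inj₁ pq
  ...   | no z≢q = inj₂ (proj₂ (in-third ps qs pq zs (≢-sym w≢z) z≢q))
  in-semicomplete {s} {p} {q} {w} {z} ps qs pq ws zs w≢z | no w≢p with z ≟ p | w ≟ q
  ... | yes refl | yes refl = inj₂ pq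
  ... | yes refl | no w≢q = inj₁ (proj₂ (in-third ps qs pq ws w≢p w≢q))
  ... | no z≢p | yes refl = inj₁ (proj₁ (in-third ps qs pq zs z≢p (≢-sym w≢z)))
  ... | no z≢p | no w≢q =
    inj₂ (proj₂ (in-third ws ps (proj₂ (in-third ps qs pq ws w≢p w≢q)) zs
      (≢-sym w≢z) z≢p))

-- Slots and their numbering

Slot : ℕ → Set
Slot n = Fin n ⊎ (Fin n ⊎ Fin n)

pattern left s  = inj₁ s
pattern right s = inj₂ (inj₁ s)
pattern after b = inj₂ (inj₂ b)

-- `Marriage` matches into `Fin k`, so slots are numbered there.
encode : ∀ {n} → Slot n → Fin (n + (n + n))
encode {n} = join n (n + n) ∘ map₂ (join n n)

decode : ∀ {n} → Fin (n + (n + n)) → Slot n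
decode {n} = map₂ (splitAt n) ∘ splitAt n

decode-encode : ∀ {n} (q : Slot n) → decode (encode q) ≡ q
decode-encode {n} (inj₁ s) = cong (map₂ (splitAt n)) (splitAt-join n (n + n) (inj₁ s))
decode-encode {n} (inj₂ q) = trans (cong (map₂ (splitAt n)) (splitAt-join n (n + n) (inj₂ (join n n q))))
                                   (cong inj₂ (splitAt-join n n q))

encode-decode : ∀ {n} (i : Fin (n + (n + n))) → encode (decode {n} i) ≡ i
encode-decode {n} i = trans (cong (join n (n + n)) (map₂-join (splitAt n i))) (join-splitAt n (n + n) i)
  where
  map₂-join : (q : Fin n ⊎ Fin (n + n)) → map₂ (join n n) (map₂ (splitAt n) q) ≡ q
  map₂-join (inj₁ s) = refl
  map₂-join (inj₂ q) = cong inj₂ (join-splitAt n n q)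

encode-injective : ∀ {n} {p q : Slot n} → encode p ≡ encode q → p ≡ q
encode-injective eq = trans (sym (decode-encode _)) (trans (cong decode eq) (decode-encode _))

decode-injective : ∀ {n} {i j : Fin (n + (n + n))} → decode {n} i ≡ decode j → i ≡ j
decode-injective {n} eq = trans (sym (encode-decode {n} _)) (trans (cong encode eq) (encode-decode {n} _))

data IsAfter {n} : Slot n → Set where
  isAfter : ∀ {b} → IsAfter (after b)

isAfter? : ∀ {n} (q : Slot n) → Dec (IsAfter q)
isAfter? (left _)  = no λ ()
isAfter? (right _) = no λ ()
isAfter? (after _) = yes isAfter

-- Hall's condition for the core vertices

module Assignment (D : Digraph) (anti : AntiCirculant (Arc D)) {X S : Subset (n D)}
                  (max : IsMaxStableIn D X S) where

  E : V D → V D → Set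
  E = Arc D

  E? : ∀ u v → Dec (E u v)
  E? u v = adj D u v Bool.≟ true

  irrefl : ∀ {v} → ¬ E v v
  irrefl {v} e with trans (sym e) (loopless D v)
  ... | ()

  S⊆X : S ⊆ X
  S⊆X = proj₁ (proj₁ max)

  S-independent : ∀ {s t} → s ∈ S → t ∈ S → ¬ E s t
  S-independent = proj₂ (proj₁ max) _ _

  adjacent? : ∀ u v → Dec (Adjacent E u v)
  adjacent? u v = E? u v ⊎-dec E? v u

  Outer : V D → Set
  Outer v = v ∈ X × v ∉ S

  outer? : ∀ v → Dec (Outer v)
  outer? v = v ∈? X ×-dec ¬? (v ∈? S)

  attached? : ∀ Z s → Dec (s ∈ S × ∃ λ z → z ∈ Z × Adjacent E s z)
  attached? Z s = s ∈? S ×-dec any? λ z → z ∈? Z ×-dec adjacent? s z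

  attachments : Subset (n D) → Subset (n D)
  attachments Z = select (attached? Z)

  -- Exchange argument: `Z` together with the vertices of `S` not attached to it is stable, hence no
  -- larger than `S`.
  independent-bound : ∀ Z → (∀ {z} → z ∈ Z → Outer z) → (∀ {y z} → y ∈ Z → z ∈ Z → ¬ E y z) →
                      ∣ Z ∣ ≤ ∣ attachments Z ∣
  independent-bound Z outer indep = +-cancelˡ-≤ ∣ S ─ N ∣ _ _ (begin
    ∣ S ─ N ∣ + ∣ Z ∣  ≤⟨ disjoint⇒∣p∣+∣q∣≤∣p∪q∣ (S ─ N) Z (λ s∈ s∈Z → proj₂ (outer s∈Z) (p─q⊆p S N s∈)) ⟩
    ∣ (S ─ N) ∪ Z ∣    ≤⟨ proj₂ max _ (T⊆X , T-indep) ⟩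
    ∣ S ∣              ≤⟨ p⊆q⇒∣p∣≤∣q∣ cover ⟩
    ∣ (S ─ N) ∪ N ∣    ≤⟨ ∣p∪q∣≤∣p∣+∣q∣ (S ─ N) N ⟩
    ∣ S ─ N ∣ + ∣ N ∣  ∎)
    where
    open ≤-Reasoning
    N = attachments Z
    T⊆X : (S ─ N) ∪ Z ⊆ X
    T⊆X v∈ with x∈p∪q⁻ (S ─ N) Z v∈
    ... | inj₁ v∈S = S⊆X (p─q⊆p S N v∈S)
    ... | inj₂ v∈Z = proj₁ (outer v∈Z)
    unattached : ∀ {s z} → s ∈ S ─ N → z ∈ Z → ¬ Adjacent E s z
    unattached s∈ z∈Z a = x∈p─q⇒x∉q S N s∈ (∈-select⁺ (attached? Z) (p─q⊆p S N s∈ , _ , z∈Z , a))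
    T-indep : ∀ u v → u ∈ (S ─ N) ∪ Z → v ∈ (S ─ N) ∪ Z → ¬ E u v
    T-indep u v u∈ v∈ e with x∈p∪q⁻ (S ─ N) Z u∈ | x∈p∪q⁻ (S ─ N) Z v∈
    ... | inj₁ u∈S | inj₁ v∈S = S-independent (p─q⊆p S N u∈S) (p─q⊆p S N v∈S) e
    ... | inj₁ u∈S | inj₂ v∈Z = unattached u∈S v∈Z (inj₁ e)
    ... | inj₂ u∈Z | inj₁ v∈S = unattached v∈S u∈Z (inj₂ e)
    ... | inj₂ u∈Z | inj₂ v∈Z = indep u∈Z v∈Z e
    cover : S ⊆ (S ─ N) ∪ N
    cover {s} s∈S with s ∈? N
    ... | yes s∈N = x∈p∪q⁺ (inj₂ s∈N)
    ... | no s∉N  = x∈p∪q⁺ (inj₁ (x∈p∧x∉q⇒x∈p─q s∈S s∉N))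

  open DecL {A = V D} _≟_ using () renaming (_∈?_ to _∈ₗ?_)

  -- Otherwise all attachments of `zs` lie in `ss`, so `independent-bound` gives
  -- `length zs ≤ length ss`. The empty set `⊥` lets the list-counting lemmas be used on both sides.
  independent-escape : ∀ {zs} ss → Unique zs → All Outer zs →
                       AllPairs (λ y z → ¬ Adjacent E y z) zs → length ss < length zs →
                       ∃ λ u → u ∈ S × u L.∉ ss × Any (Adjacent E u) zs
  independent-escape {zs} ss uzs outer indep lt
    with any? (λ u → u ∈? S ×-dec ¬? (u ∈ₗ? ss) ×-dec Any.any? (adjacent? u) zs)
  ... | yes found = found
  ... | no none = contradiction lt (≤⇒≯ (begin
    length zs                ≤⟨ m≤n+m _ ∣ ⊥ {n D} ∣ ⟩
    ∣ ⊥ {n D} ∣ + length zs  ≤⟨ ∣q∣+length≤∣p∣ uzs (⊥-elim ∘ ∉⊥) (All.tabulate (∈-select⁺ (_∈ₗ? zs)))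
                                  (All.tabulate λ _ → ∉⊥) ⟩
    ∣ Z ∣                    ≤⟨ independent-bound Z (All.lookup outer ∘ ∈Z⁻) (λ y∈ z∈ → Z-indep indep (∈Z⁻ y∈) (∈Z⁻ z∈)) ⟩
    ∣ attachments Z ∣        ≤⟨ ∣p∣≤∣q∣+length ss {q = ⊥} (λ u∈ u∉ss → ⊥-elim (unescaped u∈ u∉ss)) ⟩
    ∣ ⊥ {n D} ∣ + length ss  ≡⟨ cong (_+ length ss) (∣⊥∣≡0 (n D)) ⟩
    length ss                ∎))
    where
    open ≤-Reasoning
    Z = select (_∈ₗ? zs)
    ∈Z⁻ : ∀ {z} → z ∈ Z → z L.∈ zs
    ∈Z⁻ = ∈-select⁻ (_∈ₗ? zs)
    Z-indep : ∀ {zs y z} → AllPairs (λ y z → ¬ Adjacent E y z) zs → y L.∈ zs → z L.∈ zs → ¬ E y z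
    Z-indep (_ ∷ _) (here refl) (here refl) e = irrefl e
    Z-indep (p ∷ _) (here refl) (there z∈) e = All.lookup p z∈ (inj₁ e)
    Z-indep (p ∷ _) (there y∈) (here refl) e = All.lookup p y∈ (inj₂ e)
    Z-indep (_ ∷ i) (there y∈) (there z∈) e = Z-indep i y∈ z∈ e
    unescaped : ∀ {u} → u ∈ attachments Z → ¬ (u L.∉ ss)
    unescaped u∈ u∉ss with ∈-select⁻ (attached? Z) u∈
    ... | u∈S , z , z∈Z , a = none (_ , u∈S , u∉ss , L.lose (∈Z⁻ z∈Z) a)

  -- A port is dense if it contains an arc, and then it is semicomplete. Arcs are sought in all of
  -- `D`, not only in `X`.
  DenseIn DenseOut HasIn HasOut Core : V D → Set
  DenseIn s = ∃ λ p → ∃ λ q → E p s × E q s × E p q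
  DenseOut s = ∃ λ p → ∃ λ q → E s p × E s q × E p q
  HasIn v = ∃ λ s → s ∈ S × E s v
  HasOut v = ∃ λ s → s ∈ S × E v s
  Core v = Outer v × (∀ s → s ∈ S → E v s → ¬ DenseIn s) × (∀ s → s ∈ S → E s v → ¬ DenseOut s)

  denseIn? : ∀ s → Dec (DenseIn s)
  denseIn? s = any? λ p → any? λ q → E? p s ×-dec E? q s ×-dec E? p q

  denseOut? : ∀ s → Dec (DenseOut s)
  denseOut? s = any? λ p → any? λ q → E? s p ×-dec E? s q ×-dec E? p q

  hasIn? : ∀ v → Dec (HasIn v)
  hasIn? v = any? λ s → s ∈? S ×-dec E? s v

  hasOut? : ∀ v → Dec (HasOut v)
  hasOut? v = any? λ s → s ∈? S ×-dec E? v s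

  core? : ∀ v → Dec (Core v)
  core? v = outer? v
      ×-dec all? (λ s → s ∈? S →-dec E? v s →-dec ¬? (denseIn? s))
      ×-dec all? (λ s → s ∈? S →-dec E? s v →-dec ¬? (denseOut? s))

  -- In the last clause `¬ HasOut b` bars `b` from every left slot and from every after slot, since
  -- both demand an arc to `S`. So `b` can only hold a right slot, and no chains of after slots
  -- arise.
  Admits : V D → Slot (n D) → Set
  Admits v (left s)  = s ∈ S × E v s
  Admits v (right s) = s ∈ S × E s v
  Admits v (after b) = Core b × ¬ HasOut b × HasOut v × E b v

  admits? : ∀ v q → Dec (Admits v q)
  admits? v (left s)  = s ∈? S ×-dec E? v s
  admits? v (right s) = s ∈? S ×-dec E? s v
  admits? v (after b) = core? b ×-dec ¬? (hasOut? b) ×-dec hasOut? v ×-dec E? b v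

  outer-attached : ∀ {v} → Outer v → HasIn v ⊎ HasOut v
  outer-attached Ov with independent-escape [] ([] ∷ []) (Ov ∷ []) ([] ∷ []) (s≤s z≤n)
  ... | s , s∈S , _ , here (inj₁ sv) = inj₁ (s , s∈S , sv)
  ... | s , s∈S , _ , here (inj₂ vs) = inj₂ (s , s∈S , vs)

  open Marriage {R = λ v i → Admits v (decode i)} (λ v i → admits? v (decode i))

  slots : Subset (n D) → Subset (n D + (n D + n D))
  slots = neighbours ⊤

  ∈-slots⁺ : ∀ {Y v} q → v ∈ Y → Admits v q → encode q ∈ slots Y
  ∈-slots⁺ {Y} q v∈Y adm = ∈-neighbours⁺ {⊤} {Y} ∈⊤ v∈Y (subst (Admits _) (sym (decode-encode q)) adm)

  ∈-slots⁻ : ∀ {Y i} → i ∈ slots Y → ∃ λ v → v ∈ Y × Admits v (decode i)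
  ∈-slots⁻ {Y} = proj₂ ∘ ∈-neighbours⁻ {⊤} {Y}

  remaining? : ∀ Y ys v → Dec (v ∈ Y × v L.∉ ys)
  remaining? Y ys v = v ∈? Y ×-dec ¬? (v ∈ₗ? ys)

  remaining : Subset (n D) → List (V D) → Subset (n D)
  remaining Y ys = select (remaining? Y ys)

  remaining-< : ∀ {Y ys y} → y ∈ Y → y L.∈ ys → ∣ remaining Y ys ∣ < ∣ Y ∣
  remaining-< {Y} {ys} y∈Y y∈ys = p⊂q⇒∣p∣<∣q∣
    (proj₁ ∘ ∈-select⁻ (remaining? Y ys) , _ , y∈Y , λ y∈ → proj₂ (∈-select⁻ (remaining? Y ys) y∈) y∈ys)

  -- The reduction step: the slots `qs` are used by `Y` but by nothing left once `ys` is removed, so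
  -- the removal loses at least as many slots as vertices.
  remaining-bound : ∀ {Y} ys qs → Unique qs → length ys ≤ length qs →
                    (∀ {q} → q L.∈ qs → ∃ λ y → y ∈ Y × Admits y q) →
                    (∀ {q y} → q L.∈ qs → y ∈ Y → Admits y q → y L.∈ ys) →
                    ∣ remaining Y ys ∣ ≤ ∣ slots (remaining Y ys) ∣ → ∣ Y ∣ ≤ ∣ slots Y ∣
  remaining-bound {Y} ys qs uqs len used closed ih = begin
    ∣ Y ∣
      ≤⟨ ∣p∣≤∣q∣+length ys (λ y∈Y y∉ys → ∈-select⁺ (remaining? Y ys) (y∈Y , y∉ys)) ⟩
    ∣ remaining Y ys ∣ + length ys
      ≤⟨ +-mono-≤ ih len ⟩
    ∣ slots (remaining Y ys) ∣ + length qs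
      ≡⟨ cong (∣ slots (remaining Y ys) ∣ +_) (sym (length-map encode qs)) ⟩
    ∣ slots (remaining Y ys) ∣ + length (map encode qs)
      ≤⟨ ∣q∣+length≤∣p∣ (Unique.map⁺ encode-injective uqs) sub
           (All.map⁺ (All.tabulate used′)) (All.map⁺ (All.tabulate unused)) ⟩
    ∣ slots Y ∣ ∎
    where
    open ≤-Reasoning
    sub : slots (remaining Y ys) ⊆ slots Y
    sub {i} i∈ with ∈-slots⁻ {remaining Y ys} i∈
    ... | v , v∈ , adm = ∈-neighbours⁺ {⊤} {Y} ∈⊤ (proj₁ (∈-select⁻ (remaining? Y ys) v∈)) adm
    used′ : ∀ {q} → q L.∈ qs → encode q ∈ slots Y
    used′ {q} q∈ with used q∈
    ... | y , y∈Y , adm = ∈-slots⁺ q y∈Y adm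
    unused : ∀ {q} → q L.∈ qs → encode q ∉ slots (remaining Y ys)
    unused {q} q∈ i∈ with ∈-slots⁻ {remaining Y ys} i∈
    ... | v , v∈ , adm with ∈-select⁻ (remaining? Y ys) v∈
    ...   | v∈Y , v∉ys = v∉ys (closed q∈ v∈Y (subst (Admits v) (decode-encode q) adm))

  -- The four ports of `s` and `t` are distinct slots and serve at most four vertices. The vertex
  -- `b` in `Y` makes the remainder strictly smaller.
  closed⇒bound : ∀ {Y} → ClosedQuadruple E (_∈ S) (_∈ Y) →
                 (∀ ys {y} → y ∈ Y → y L.∈ ys → ∣ remaining Y ys ∣ ≤ ∣ slots (remaining Y ys) ∣) →
                 ∣ Y ∣ ≤ ∣ slots Y ∣
  closed⇒bound {Y} c ih = remaining-bound (b ∷ x ∷ b′ ∷ x′ ∷ []) qs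
    (((λ { refl → s≢t refl }) ∷ (λ ()) ∷ (λ ()) ∷ []) ∷ ((λ ()) ∷ (λ ()) ∷ []) ∷
     ((λ { refl → s≢t refl }) ∷ []) ∷ [] ∷ [])
    ≤-refl used closed′ (ih (b ∷ x ∷ b′ ∷ x′ ∷ []) Yb (here refl))
    where
    open ClosedQuadruple c
    qs = left s ∷ left t ∷ right s ∷ right t ∷ []
    used : ∀ {q} → q L.∈ qs → ∃ λ y → y ∈ Y × Admits y q
    used (here refl) = let y , Yy , e = in-s in y , Yy , Ss , e
    used (there (here refl)) = let y , Yy , e = in-t in y , Yy , St , e
    used (there (there (here refl))) = let y , Yy , e = out-s in y , Yy , Ss , e
    used (there (there (there (here refl)))) = let y , Yy , e = out-t in y , Yy , St , e
    closed′ : ∀ {q y} → q L.∈ qs → y ∈ Y → Admits y q → y L.∈ b ∷ x ∷ b′ ∷ x′ ∷ []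
    closed′ (here refl) Yy (_ , e) = closed Yy (inj₁ (inj₁ e))
    closed′ (there (here refl)) Yy (_ , e) = closed Yy (inj₂ (inj₁ e))
    closed′ (there (there (here refl))) Yy (_ , e) = closed Yy (inj₁ (inj₂ e))
    closed′ (there (there (there (here refl)))) Yy (_ , e) = closed Yy (inj₂ (inj₂ e))

  module Counting {Y} (core : ∀ {y} → y ∈ Y → Core y)
                  (¬out-out : ∀ {b x} → b ∈ Y → x ∈ Y → E b x → HasOut b → ¬ HasOut x)
                  (¬in-in : ∀ {b x} → b ∈ Y → x ∈ Y → E b x → HasIn b → ¬ HasIn x)
                  (¬out-in : ∀ {b x} → b ∈ Y → x ∈ Y → E b x → HasOut b → ¬ HasIn x) where

    parent? : ∀ b → Dec (b ∈ Y × ¬ HasOut b × ∃ λ x → x ∈ Y × E b x)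
    parent? b = b ∈? Y ×-dec ¬? (hasOut? b) ×-dec any? λ x → x ∈? Y ×-dec E? b x

    P Z N : Subset (n D)
    P = select parent?
    Z = Y ─ P
    N = attachments Z

    Z⊆Y : Z ⊆ Y
    Z⊆Y = p─q⊆p Y P

    -- The tail of an arc in `Z` is not in `P`, so it has an arc to `S`; its head has some arc with
    -- `S`, and both directions are excluded.
    Z-independent : ∀ {y z} → y ∈ Z → z ∈ Z → ¬ E y z
    Z-independent {y} {z} y∈Z z∈Z e with hasOut? y
    ... | no ¬out = x∈p─q⇒x∉q Y P y∈Z (∈-select⁺ parent? (Z⊆Y y∈Z , ¬out , z , Z⊆Y z∈Z , e))
    ... | yes out with outer-attached (proj₁ (core (Z⊆Y z∈Z)))
    ...   | inj₁ has-in  = ¬out-in (Z⊆Y y∈Z) (Z⊆Y z∈Z) e out has-in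
    ...   | inj₂ has-out = ¬out-out (Z⊆Y y∈Z) (Z⊆Y z∈Z) e out has-out

    afterSlot? : ∀ i → Dec (i ∈ slots Y × IsAfter (decode {n D} i))
    afterSlot? i = i ∈? slots Y ×-dec isAfter? (decode i)

    portSlot? : ∀ i → Dec (i ∈ slots Y × ¬ IsAfter (decode {n D} i))
    portSlot? i = i ∈? slots Y ×-dec ¬? (isAfter? (decode i))

    -- Each `b` in `P` is charged to its own slot `after b`. As `b` has only arcs from `S`, `¬in-in`
    -- forces its out-neighbour in `Y` to have an arc to `S`, so that this neighbour may use the
    -- slot.
    ∣P∣≤ : ∣ P ∣ ≤ ∣ select afterSlot? ∣
    ∣P∣≤ = ∣∣-mono-injection (λ b → encode (after b)) into λ _ _ eq → after-injective (encode-injective eq)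
      where
      after-injective : ∀ {b c : V D} → (Slot (n D) ∋ after b) ≡ after c → b ≡ c
      after-injective refl = refl
      into : ∀ {b} → b ∈ P → encode (after b) ∈ select afterSlot?
      into {b} b∈P with ∈-select⁻ parent? b∈P
      ... | b∈Y , ¬out , x , x∈Y , bx with outer-attached (proj₁ (core b∈Y)) | outer-attached (proj₁ (core x∈Y))
      ...   | inj₂ out | _ = contradiction out ¬out
      ...   | inj₁ in-b | inj₁ in-x = contradiction in-x (¬in-in b∈Y x∈Y bx in-b)
      ...   | inj₁ _ | inj₂ out-x = ∈-select⁺ afterSlot?
        (∈-slots⁺ {Y} (after b) x∈Y (core b∈Y , ¬out , out-x , bx) ,
         subst IsAfter (sym (decode-encode (after b))) isAfter)

    entering? : ∀ s → Dec (∃ λ z → z ∈ Z × E z s)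
    entering? s = any? λ z → z ∈? Z ×-dec E? z s

    -- Chooses one port of `s` that `Z` uses, the left one if possible; distinct `s` thus account
    -- for distinct slots.
    port : V D → Slot (n D)
    port s = if does (entering? s) then left s else right s

    port-injective : ∀ {s t} → port s ≡ port t → s ≡ t
    port-injective {s} {t} eq with entering? s | entering? t
    port-injective refl | yes _ | yes _ = refl
    port-injective ()   | yes _ | no _
    port-injective ()   | no _  | yes _
    port-injective refl | no _  | no _ = refl

    ∣N∣≤ : ∣ N ∣ ≤ ∣ select portSlot? ∣
    ∣N∣≤ = ∣∣-mono-injection (encode ∘ port)
      (λ s∈ → ∈-select⁺ portSlot? (into s∈ , λ a → ¬after _ (subst IsAfter (decode-encode (port _)) a)))
      (λ _ _ → port-injective ∘ encode-injective)
      where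
      ¬after : ∀ s → ¬ IsAfter (port s)
      ¬after s a with entering? s
      ¬after s () | yes _
      ¬after s () | no _
      into : ∀ {s} → s ∈ N → encode (port s) ∈ slots Y
      into {s} s∈N with entering? s | ∈-select⁻ (attached? Z) s∈N
      ... | yes (z , z∈Z , zs) | s∈S , _ = ∈-slots⁺ {Y} (left s) (Z⊆Y z∈Z) (s∈S , zs)
      ... | no _  | s∈S , z , z∈Z , inj₁ sz = ∈-slots⁺ {Y} (right s) (Z⊆Y z∈Z) (s∈S , sz)
      ... | no ¬e | s∈S , z , z∈Z , inj₂ zs = contradiction (z , z∈Z , zs) ¬e

    bound : ∣ Y ∣ ≤ ∣ slots Y ∣
    bound = begin
      ∣ Y ∣                                          ≤⟨ p⊆q⇒∣p∣≤∣q∣ cover ⟩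
      ∣ Z ∪ P ∣                                      ≤⟨ ∣p∪q∣≤∣p∣+∣q∣ Z P ⟩
      ∣ Z ∣ + ∣ P ∣                                  ≤⟨ +-mono-≤ ∣Z∣≤ ∣P∣≤ ⟩
      ∣ select portSlot? ∣ + ∣ select afterSlot? ∣   ≤⟨ disjoint⇒∣p∣+∣q∣≤∣p∪q∣ _ _ disjoint ⟩
      ∣ select portSlot? ∪ select afterSlot? ∣       ≤⟨ p⊆q⇒∣p∣≤∣q∣ sub ⟩
      ∣ slots Y ∣                                    ∎
      where
      open ≤-Reasoning
      ∣Z∣≤ : ∣ Z ∣ ≤ ∣ select portSlot? ∣
      ∣Z∣≤ = ≤-trans (independent-bound Z (proj₁ ∘ core ∘ Z⊆Y) Z-independent) ∣N∣≤
      disjoint : ∀ {i} → i ∈ select portSlot? → i ∉ select afterSlot?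
      disjoint i∈ i∈′ = proj₂ (∈-select⁻ portSlot? i∈) (proj₂ (∈-select⁻ afterSlot? i∈′))
      cover : Y ⊆ Z ∪ P
      cover {y} y∈Y with y ∈? P
      ... | yes y∈P = x∈p∪q⁺ (inj₂ y∈P)
      ... | no y∉P  = x∈p∪q⁺ (inj₁ (x∈p∧x∉q⇒x∈p─q y∈Y y∉P))
      sub : select portSlot? ∪ select afterSlot? ⊆ slots Y
      sub i∈ with x∈p∪q⁻ (select portSlot?) _ i∈
      ... | inj₁ i∈₁ = proj₁ (∈-select⁻ portSlot? i∈₁)
      ... | inj₂ i∈₂ = proj₁ (∈-select⁻ afterSlot? i∈₂)

  module Step {Y} (core : ∀ {y} → y ∈ Y → Core y)
              (ih : ∀ ys {y} → y ∈ Y → y L.∈ ys → ∣ remaining Y ys ∣ ≤ ∣ slots (remaining Y ys) ∣) where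

    lone-left? : Dec (∃ λ s → s ∈ S × ∃ λ y → y ∈ Y × E y s × ∀ z → z ∈ Y → E z s → z ≡ y)
    lone-left? = any? λ s → s ∈? S ×-dec any? λ y → y ∈? Y ×-dec E? y s ×-dec
                 all? λ z → z ∈? Y →-dec E? z s →-dec z ≟ y

    lone-right? : Dec (∃ λ s → s ∈ S × ∃ λ y → y ∈ Y × E s y × ∀ z → z ∈ Y → E s z → z ≡ y)
    lone-right? = any? λ s → s ∈? S ×-dec any? λ y → y ∈? Y ×-dec E? s y ×-dec
                  all? λ z → z ∈? Y →-dec E? s z →-dec z ≟ y

    -- A slot that only `y` can use is removed together with `y`.
    lone⇒bound : ∀ q {y} → y ∈ Y → Admits y q → (∀ {z} → z ∈ Y → Admits z q → z ≡ y) → ∣ Y ∣ ≤ ∣ slots Y ∣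
    lone⇒bound q {y} y∈Y adm only = remaining-bound (y ∷ []) (q ∷ []) ([] ∷ []) ≤-refl
      (λ { (here refl) → y , y∈Y , adm }) (λ { (here refl) z∈Y adm′ → here (only z∈Y adm′) })
      (ih (y ∷ []) y∈Y (here refl))

    out-out? : Dec (∃ λ b → ∃ λ x → b ∈ Y × x ∈ Y × E b x × HasOut b × HasOut x)
    out-out? = any? λ b → any? λ x → b ∈? Y ×-dec x ∈? Y ×-dec E? b x ×-dec hasOut? b ×-dec hasOut? x

    in-in? : Dec (∃ λ b → ∃ λ x → b ∈ Y × x ∈ Y × E b x × HasIn b × HasIn x)
    in-in? = any? λ b → any? λ x → b ∈? Y ×-dec x ∈? Y ×-dec E? b x ×-dec hasIn? b ×-dec hasIn? x

    configuration : ¬ (∃ λ s → s ∈ S × ∃ λ y → y ∈ Y × E y s × ∀ z → z ∈ Y → E z s → z ≡ y) →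
                    ¬ (∃ λ s → s ∈ S × ∃ λ y → y ∈ Y × E s y × ∀ z → z ∈ Y → E s z → z ≡ y) →
                    Configuration E (_∈ S) (_∈ Y)
    configuration ¬lone-left ¬lone-right = record
      { anti = λ {v₁} → anti {v₁}
      ; S-stable = S-independent
      ; Y≢S = λ { y∈Y s∈S refl → proj₂ (proj₁ (core y∈Y)) s∈S }
      ; in-indep = λ s∈S y∈Y z∈Y ys zs yz → proj₁ (proj₂ (core y∈Y)) _ s∈S ys (_ , _ , ys , zs , yz)
      ; out-indep = λ s∈S y∈Y z∈Y sy sz yz → proj₂ (proj₂ (core y∈Y)) _ s∈S sy (_ , _ , sy , sz , yz)
      ; in-other = in-other
      ; out-other = out-other
      ; escape = λ ss uzs zs∈Y → independent-escape ss uzs (All.map (proj₁ ∘ core) zs∈Y)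
      }
      where
      in-other : ∀ {s y} → s ∈ S → y ∈ Y → E y s → ∃ λ z → z ∈ Y × z ≢ y × E z s
      in-other {s} {y} s∈S y∈Y ys with any? (λ z → z ∈? Y ×-dec ¬? (z ≟ y) ×-dec E? z s)
      ... | yes other = other
      ... | no none = contradiction (s , s∈S , y , y∈Y , ys , only) ¬lone-left
        where
        only : ∀ z → z ∈ Y → E z s → z ≡ y
        only z z∈Y zs with z ≟ y
        ... | yes z≡y = z≡y
        ... | no z≢y = contradiction (z , z∈Y , z≢y , zs) none
      out-other : ∀ {s y} → s ∈ S → y ∈ Y → E s y → ∃ λ z → z ∈ Y × z ≢ y × E s z
      out-other {s} {y} s∈S y∈Y sy with any? (λ z → z ∈? Y ×-dec ¬? (z ≟ y) ×-dec E? s z)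
      ... | yes other = other
      ... | no none = contradiction (s , s∈S , y , y∈Y , sy , only) ¬lone-right
        where
        only : ∀ z → z ∈ Y → E s z → z ≡ y
        only z z∈Y sz with z ≟ y
        ... | yes z≡y = z≡y
        ... | no z≢y = contradiction (z , z∈Y , z≢y , sz) none

    step : ∣ Y ∣ ≤ ∣ slots Y ∣
    step with lone-left? | lone-right?
    ... | yes (s , s∈S , y , y∈Y , ys , only) | _ =
      lone⇒bound (left s) y∈Y (s∈S , ys) λ z∈Y (_ , zs) → only _ z∈Y zs
    ... | no _ | yes (s , s∈S , y , y∈Y , sy , only) =
      lone⇒bound (right s) y∈Y (s∈S , sy) λ z∈Y (_ , sz) → only _ z∈Y sz
    ... | no ¬ll | no ¬lr with out-out? | in-in?
    ...   | yes (b , x , b∈Y , x∈Y , bx , (s , s∈S , bs) , (t , t∈S , xt)) | _ =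
      closed⇒bound c ih
      where c = Local.out-out⇒closed _≟_ (configuration ¬ll ¬lr) b∈Y x∈Y s∈S t∈S bx bs xt
    ...   | no _ | yes (b , x , b∈Y , x∈Y , bx , (s , s∈S , sb) , (t , t∈S , tx)) =
      closed⇒bound c ih
      where
      -- In the reversed digraph the arc runs from `x` to `b`, and both have arcs to `S`.
      c = ClosedQuadruple-flip (Local.out-out⇒closed _≟_ (Configuration-flip (configuration ¬ll ¬lr))
            x∈Y b∈Y t∈S s∈S bx tx sb)
    ...   | no ¬oo | no ¬ii = Counting.bound core
      (λ b∈Y x∈Y bx out-b out-x → ¬oo (_ , _ , b∈Y , x∈Y , bx , out-b , out-x))
      (λ b∈Y x∈Y bx in-b in-x → ¬ii (_ , _ , b∈Y , x∈Y , bx , in-b , in-x))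
      (λ b∈Y x∈Y bx (s , s∈S , bs) (t , t∈S , tx) →
        Local.¬out-in _≟_ (configuration ¬ll ¬lr)
          (λ b∈Y x∈Y s∈S t∈S bx sb tx → ¬ii (_ , _ , b∈Y , x∈Y , bx , (_ , s∈S , sb) , (_ , t∈S , tx)))
          b∈Y x∈Y s∈S t∈S bx bs tx)

  -- Induction on the size of `Y` in place of a minimal violating set: wherever minimality would be
  -- invoked, the bound for a smaller remainder is used.
  slots-bound : ∀ j Y → ∣ Y ∣ ≤ j → (∀ {y} → y ∈ Y → Core y) → ∣ Y ∣ ≤ ∣ slots Y ∣
  slots-bound zero Y ∣Y∣≤0 core = ≤-trans ∣Y∣≤0 z≤n
  slots-bound (suc j) Y ∣Y∣≤1+j core = Step.step core λ ys y∈Y y∈ys →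
    slots-bound j (remaining Y ys) (≤-pred (≤-trans (remaining-< y∈Y y∈ys) ∣Y∣≤1+j))
      (core ∘ proj₁ ∘ ∈-select⁻ (remaining? Y ys))

  core-matching : ∃ λ (f : V D → Slot (n D)) →
    (∀ {v} → Core v → Admits v (f v)) × (∀ {u v} → Core u → Core v → f u ≡ f v → u ≡ v)
  -- The default `encode ∘ left` is an arbitrary choice; only the values at core vertices are
  -- constrained.
  core-matching with hall (encode ∘ left) (select core?) ⊤
    (λ Y Y⊆core → slots-bound ∣ Y ∣ Y ≤-refl (∈-select⁻ core? ∘ Y⊆core))
  ... | f , f-ok , f-inj = decode ∘ f , (λ c → proj₂ (f-ok (∈-select⁺ core? c))) ,
        λ c d eq → f-inj (∈-select⁺ core? c) (∈-select⁺ core? d) (decode-injective {n D} eq)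

  -- From the matching to the path partition

  out-semicomplete : ∀ {s p q w z} → E s p → E s q → E p q → E s w → E s z → w ≢ z → Adjacent E w z
  out-semicomplete sp sq pq sw sz w≢z =
    in-semicomplete (AntiCirculant-flip anti) irrefl sq sp pq sz sw (≢-sym w≢z)

  left≢right : ∀ {s t} → (Slot (n D) ∋ left s) ≢ right t
  left≢right ()

  left≢after : ∀ {s t} → (Slot (n D) ∋ left s) ≢ after t
  left≢after ()

  right≢after : ∀ {s t} → (Slot (n D) ∋ right s) ≢ after t
  right≢after ()

  left-injective : ∀ {s t} → (Slot (n D) ∋ left s) ≡ left t → s ≡ t
  left-injective refl = refl

  right-injective : ∀ {s t} → (Slot (n D) ∋ right s) ≡ right t → s ≡ t
  right-injective refl = refl

  Assigned : (V D → Slot (n D)) → V D → Slot (n D) → Set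
  Assigned f v q = (Core v × q ≡ f v)
                 ⊎ (∃ λ s → q ≡ left s × s ∈ S × E v s × DenseIn s)
                 ⊎ (∃ λ s → q ≡ right s × s ∈ S × E s v × DenseOut s)

  -- A dense port has room for everybody, so it is preferred; a vertex of `X` outside `S` without
  -- one is core and takes its matched slot. The slot is chosen for every `v`, and only its
  -- specification asks for `Outer v`, so slots do not depend on proofs.
  assign : ∀ f v → ∃ λ q → Outer v → Assigned f v q
  assign f v with any? (λ s → s ∈? S ×-dec E? v s ×-dec denseIn? s)
                | any? (λ s → s ∈? S ×-dec E? s v ×-dec denseOut? s)
  ... | yes (s , in-s) | _ = left s , λ _ → inj₂ (inj₁ (s , refl , in-s))
  ... | no _ | yes (s , out-s) = right s , λ _ → inj₂ (inj₂ (s , refl , out-s))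
  ... | no ¬in | no ¬out = f v , λ Ov → inj₁
    ((Ov , (λ s s∈S e d → ¬in (s , s∈S , e , d)) , (λ s s∈S e d → ¬out (s , s∈S , e , d))) , refl)

  module Partition (f : V D → Slot (n D)) (f-admits : ∀ {v} → Core v → Admits v (f v))
                   (f-injective : ∀ {u v} → Core u → Core v → f u ≡ f v → u ≡ v) where

    slot : V D → Slot (n D)
    slot v = proj₁ (assign f v)

    assigned : ∀ {v} → Outer v → Assigned f v (slot v)
    assigned {v} = proj₂ (assign f v)

    slot-admits : ∀ {v} → Outer v → Admits v (slot v)
    slot-admits Ov with assigned Ov
    ... | inj₁ (c , eq) = subst (Admits _) (sym eq) (f-admits c)
    ... | inj₂ (inj₁ (s , eq , s∈S , vs , _)) = subst (Admits _) (sym eq) (s∈S , vs)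
    ... | inj₂ (inj₂ (s , eq , s∈S , sv , _)) = subst (Admits _) (sym eq) (s∈S , sv)

    admits : ∀ {v q} → Outer v → slot v ≡ q → Admits v q
    admits Ov refl = slot-admits Ov

    slot-core : ∀ {v} → Core v → slot v ≡ f v
    slot-core c@(Ov , ¬in , ¬out) with assigned Ov
    ... | inj₁ (_ , eq) = eq
    ... | inj₂ (inj₁ (s , _ , s∈S , vs , dense)) = contradiction dense (¬in s s∈S vs)
    ... | inj₂ (inj₂ (s , _ , s∈S , sv , dense)) = contradiction dense (¬out s s∈S sv)

    after-core : ∀ {v b} → Outer v → slot v ≡ after b → Core v
    after-core Ov eq with assigned Ov
    ... | inj₁ (c , _) = c
    ... | inj₂ (inj₁ (s , eq′ , _)) = contradiction (trans (sym eq′) eq) left≢after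
    ... | inj₂ (inj₂ (s , eq′ , _)) = contradiction (trans (sym eq′) eq) right≢after

    same-slot : ∀ {u v q} → Core u → Core v → slot u ≡ q → slot v ≡ q → u ≡ v
    same-slot cu cv equ eqv = f-injective cu cv
      (trans (sym (slot-core cu)) (trans equ (trans (sym eqv) (slot-core cv))))

    -- If the in-port is dense it is semicomplete; if not, both occupants are core and injectivity
    -- of the matching makes them equal.
    left-adjacent : ∀ {u v s} → Outer u → Outer v → slot u ≡ left s → slot v ≡ left s → u ≢ v → Adjacent E u v
    left-adjacent {s = s} Ou Ov equ eqv u≢v with admits Ou equ | admits Ov eqv | denseIn? s
    ... | _ , us | _ , vs | yes (p , q , ps , qs , pq) = in-semicomplete anti irrefl ps qs pq us vs u≢v
    ... | _ | _ | no ¬dense = contradiction (same-slot (core Ou equ) (core Ov eqv) equ eqv) u≢v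
      where
      core : ∀ {v} → Outer v → slot v ≡ left s → Core v
      core Ov eq with assigned Ov
      ... | inj₁ (c , _) = c
      ... | inj₂ (inj₁ (t , eq′ , _ , _ , dense)) =
        contradiction (subst DenseIn (left-injective (trans (sym eq′) eq)) dense) ¬dense
      ... | inj₂ (inj₂ (t , eq′ , _)) = contradiction (trans (sym eq) eq′) left≢right

    right-core : ∀ {v s} → ¬ DenseOut s → Outer v → slot v ≡ right s → Core v
    right-core ¬dense Ov eq with assigned Ov
    ... | inj₁ (c , _) = c
    ... | inj₂ (inj₁ (t , eq′ , _)) = contradiction (trans (sym eq′) eq) left≢right
    ... | inj₂ (inj₂ (t , eq′ , _ , _ , dense)) =
      contradiction (subst DenseOut (right-injective (trans (sym eq′) eq)) dense) ¬dense

    right-adjacent : ∀ {u v s} → Outer u → Outer v → slot u ≡ right s → slot v ≡ right s → u ≢ v → Adjacent E u v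
    right-adjacent {s = s} Ou Ov equ eqv u≢v with admits Ou equ | admits Ov eqv | denseOut? s
    ... | _ , su | _ , sv | yes (p , q , sp , sq , pq) = out-semicomplete sp sq pq su sv u≢v
    ... | _ | _ | no ¬dense =
      contradiction (same-slot (right-core ¬dense Ou equ) (right-core ¬dense Ov eqv) equ eqv) u≢v

    base-slot : ∀ {v b} → Outer v → slot v ≡ after b → ∃ λ s → slot b ≡ right s
    base-slot {b = b} Ov eq with admits Ov eq
    ... | cb , ¬out , _ with f b | slot-core cb | f-admits cb
    ...   | left s  | _   | adm = contradiction (s , adm) ¬out
    ...   | right s | eq′ | _ = s , eq′
    ...   | after _ | _   | _ , _ , out , _ = contradiction out ¬out

    Behind : V D → V D → Set
    Behind v s = slot v ≡ right s ⊎ (∃ λ b → slot v ≡ after b × slot b ≡ right s)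

    _≟ˢ_ : (p q : Slot (n D)) → Dec (p ≡ q)
    _≟ˢ_ = ≡-dec _≟_ (≡-dec _≟_ _≟_)

    fibre? : ∀ q v → Dec (Outer v × slot v ≡ q)
    fibre? q v = outer? v ×-dec slot v ≟ˢ q

    fibre : Slot (n D) → List (V D)
    fibre q = filter (fibre? q) (allFin (n D))

    fibre-unique : ∀ q → Unique (fibre q)
    fibre-unique q = Unique.filter⁺ (fibre? q) (Unique.allFin⁺ (n D))

    record Segment (P : V D → Set) : Set where
      field
        vertices : List (V D)
        unique   : Unique vertices
        linked   : Linked E vertices
        sound    : ∀ {v} → v L.∈ vertices → P v
        complete : ∀ {v} → P v → v L.∈ vertices

    fibre-segment : ∀ q → (∀ {u v} → Outer u → Outer v → slot u ≡ q → slot v ≡ q → u ≢ v → Adjacent E u v) →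
                    Segment (λ v → Outer v × slot v ≡ q)
    fibre-segment q adj with hamiltonian-path (unique⇒AllPairs (fibre-unique q) λ u∈ v∈ →
        let _ , Ou , equ = ∈-filter⁻ (fibre? q) {xs = allFin (n D)} u∈
            _ , Ov , eqv = ∈-filter⁻ (fibre? q) {xs = allFin (n D)} v∈
        in adj Ou Ov equ eqv)
    ... | ys , ys↭ , link = record
      { vertices = ys
      ; unique = Permutationₛ.Unique-resp-↭ (setoid (V D)) (↭⇒↭ₛ (↭-sym ys↭)) (fibre-unique q)
      ; linked = link
      ; sound = λ v∈ → proj₂ (∈-filter⁻ (fibre? q) {xs = allFin (n D)} (∈-resp-↭ ys↭ v∈))
      ; complete = λ p → ∈-resp-↭ (↭-sym ys↭) (∈-filter⁺ (fibre? q) (∈-allFin _) p)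
      }

    left-segment : ∀ s → Segment (λ v → Outer v × slot v ≡ left s)
    left-segment s = fibre-segment (left s) left-adjacent

    -- If some `v` is placed after a `b` in the right slot of `s`, then `b` is core, so this port is
    -- stable. Injectivity then makes `b` its only occupant and `v` the only vertex after `b`, and
    -- the segment is `b v`. The link from `s` is returned as well, because `v` need not be an
    -- out-neighbour of `s`.
    right-segment : ∀ s → ∃ λ (g : Segment (λ v → Outer v × Behind v s)) → Linked E (s ∷ Segment.vertices g)
    right-segment s with any? (λ b → any? (λ v → outer? v ×-dec slot v ≟ˢ after b ×-dec slot b ≟ˢ right s))
    ... | no none = record
        { vertices = vertices ; unique = unique ; linked = linked
        ; sound = λ v∈ → let Ov , eq = sound v∈ in Ov , inj₁ eq
        ; complete = λ { (Ov , inj₁ eq) → complete (Ov , eq)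
                       ; (Ov , inj₂ (b , eq , eq′)) → contradiction (b , _ , Ov , eq , eq′) none } } ,
      Linked-∷ (All.tabulate λ v∈ → let Ov , eq = sound v∈ in proj₂ (admits Ov eq)) linked
      where open Segment (fibre-segment (right s) right-adjacent)
    ... | yes (b , v , Ov , eqv , eqb) with admits Ov eqv
    ...   | cb@(Ob , _ , ¬dense) , ¬out , out , bv with admits Ob eqb
    ...     | s∈S , sb = record
        { vertices = b ∷ v ∷ []
        ; unique = ((λ { refl → ¬out out }) ∷ []) ∷ [] ∷ []
        ; linked = bv ∷ [-]
        ; sound = λ { (here refl) → Ob , inj₁ eqb ; (there (here refl)) → Ov , inj₂ (b , eqv , eqb) }
        ; complete = complete } , sb ∷ bv ∷ [-]
      where
      is-b : ∀ {w} → Outer w → slot w ≡ right s → w ≡ b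
      is-b Ow eq = same-slot (right-core (¬dense s s∈S sb) Ow eq) cb eq eqb
      complete : ∀ {w} → Outer w × Behind w s → w L.∈ b ∷ v ∷ []
      complete (Ow , inj₁ eq) = here (is-b Ow eq)
      complete (Ow , inj₂ (c , eq , eqc)) with is-b (proj₁ (proj₁ (admits Ow eq))) eqc
      ... | refl = there (here (same-slot (after-core Ow eq) (after-core Ov eqv) eq eqv))

    lefts rights path : V D → List (V D)
    lefts s = Segment.vertices (left-segment s)
    rights s = Segment.vertices (proj₁ (right-segment s))
    path s = lefts s ++ s ∷ rights s

    -- Membership in `path s` expressed through slots: disjointness of the paths becomes uniqueness
    -- of the home, and covering of `X` its existence.
    Home : V D → V D → Set
    Home v s = v ≡ s ⊎ Outer v × (slot v ≡ left s ⊎ Behind v s)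

    path⇒home : ∀ {v s} → v L.∈ path s → Home v s
    path⇒home {v} {s} v∈ with ∈-++⁻ (lefts s) v∈
    ... | inj₁ v∈l = let Ov , eq = Segment.sound (left-segment s) v∈l in inj₂ (Ov , inj₁ eq)
    ... | inj₂ (here v≡s) = inj₁ v≡s
    ... | inj₂ (there v∈r) = let Ov , eq = Segment.sound (proj₁ (right-segment s)) v∈r in inj₂ (Ov , inj₂ eq)

    home⇒path : ∀ {v s} → Home v s → v L.∈ path s
    home⇒path {s = s} (inj₁ refl) = ∈-++⁺ʳ (lefts s) (here refl)
    home⇒path {s = s} (inj₂ (Ov , inj₁ eq)) = ∈-++⁺ˡ (Segment.complete (left-segment s) (Ov , eq))
    home⇒path {s = s} (inj₂ (Ov , inj₂ behind)) =
      ∈-++⁺ʳ (lefts s) (there (Segment.complete (proj₁ (right-segment s)) (Ov , behind)))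

    left-not-behind : ∀ {v s t} → slot v ≡ left s → ¬ Behind v t
    left-not-behind eq (inj₁ eq′) = left≢right (trans (sym eq) eq′)
    left-not-behind eq (inj₂ (_ , eq′ , _)) = left≢after (trans (sym eq) eq′)

    behind-unique : ∀ {v s t} → Behind v s → Behind v t → s ≡ t
    behind-unique (inj₁ eq) (inj₁ eq′) = right-injective (trans (sym eq) eq′)
    behind-unique (inj₁ eq) (inj₂ (_ , eq′ , _)) = contradiction (trans (sym eq) eq′) right≢after
    behind-unique (inj₂ (_ , eq , _)) (inj₁ eq′) = contradiction (trans (sym eq′) eq) right≢after
    behind-unique (inj₂ (_ , eq , eqb)) (inj₂ (_ , eq′ , eqc)) with trans (sym eq) eq′
    ... | refl = right-injective (trans (sym eqb) eqc)

    home-unique : ∀ {v s t} → s ∈ S → t ∈ S → Home v s → Home v t → s ≡ t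
    home-unique s∈S t∈S (inj₁ refl) (inj₁ refl) = refl
    home-unique s∈S t∈S (inj₁ refl) (inj₂ (Ov , _)) = contradiction s∈S (proj₂ Ov)
    home-unique s∈S t∈S (inj₂ (Ov , _)) (inj₁ refl) = contradiction t∈S (proj₂ Ov)
    home-unique s∈S t∈S (inj₂ (_ , inj₁ eq)) (inj₂ (_ , inj₁ eq′)) = left-injective (trans (sym eq) eq′)
    home-unique s∈S t∈S (inj₂ (_ , inj₁ eq)) (inj₂ (_ , inj₂ behind)) = ⊥-elim (left-not-behind eq behind)
    home-unique s∈S t∈S (inj₂ (_ , inj₂ behind)) (inj₂ (_ , inj₁ eq)) = ⊥-elim (left-not-behind eq behind)
    home-unique s∈S t∈S (inj₂ (_ , inj₂ behind)) (inj₂ (_ , inj₂ behind′)) = behind-unique behind behind′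

    home⇒∈X : ∀ {v s} → s ∈ S → Home v s → v ∈ X
    home⇒∈X s∈S (inj₁ refl) = S⊆X s∈S
    home⇒∈X s∈S (inj₂ (Ov , _)) = proj₁ Ov

    home-exists : ∀ {v} → v ∈ X → ∃ λ s → s ∈ S × Home v s
    home-exists {v} v∈X with v ∈? S
    ... | yes v∈S = v , v∈S , inj₁ refl
    ... | no v∉S with slot v in eq
    ...   | left s  = s , proj₁ (admits (v∈X , v∉S) eq) , inj₂ ((v∈X , v∉S) , inj₁ refl)
    ...   | right s = s , proj₁ (admits (v∈X , v∉S) eq) , inj₂ ((v∈X , v∉S) , inj₂ (inj₁ refl))
    ...   | after b with base-slot (v∈X , v∉S) eq
    ...     | s , eqb = s , proj₁ (admits (proj₁ (proj₁ (admits (v∈X , v∉S) eq))) eqb) ,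
                        inj₂ ((v∈X , v∉S) , inj₂ (inj₂ (b , refl , eqb)))

    lefts-outer : ∀ {s} → All (_∉ S) (lefts s)
    lefts-outer {s} = All.tabulate λ v∈ → proj₂ (proj₁ (Segment.sound (left-segment s) v∈))

    rights-outer : ∀ {s} → All (_∉ S) (rights s)
    rights-outer {s} = All.tabulate λ v∈ → proj₂ (proj₁ (Segment.sound (proj₁ (right-segment s)) v∈))

    path-isPath : ∀ {s} → s ∈ S → IsPathIn D X (path s)
    path-isPath {s} s∈S = nonempty (lefts s) , path-unique , All.tabulate (home⇒∈X s∈S ∘ path⇒home) , path-linked
      where
      open Segment
      nonempty : ∀ xs {y ys} → xs ++ y ∷ ys ≢ ([] {A = V D})
      nonempty [] ()
      nonempty (_ ∷ _) ()
      path-unique : Unique (path s)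
      path-unique = Unique.++⁺ (unique (left-segment s))
        (All.tabulate (λ { v∈ refl → All.lookup rights-outer v∈ s∈S }) ∷ unique (proj₁ (right-segment s)))
        λ { (v∈l , here refl) → All.lookup lefts-outer v∈l s∈S
          ; (v∈l , there v∈r) → left-not-behind (proj₂ (sound (left-segment s) v∈l))
                                                (proj₂ (sound (proj₁ (right-segment s)) v∈r)) }
      path-linked : Linked E (path s)
      path-linked = Linked-++-∷ (linked (left-segment s))
        (All.tabulate λ v∈ → let Ov , eq = sound (left-segment s) v∈ in proj₂ (admits Ov eq))
        (proj₂ (right-segment s))

    path-count : ∀ {s} → s ∈ S → countIn D S (path s) ≡ 1
    path-count {s} s∈S = cong length (begin
      filter (_∈? S) (path s)                                 ≡⟨ filter-++ (_∈? S) (lefts s) (s ∷ rights s) ⟩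
      filter (_∈? S) (lefts s) ++ filter (_∈? S) (s ∷ rights s) ≡⟨ cong₂ _++_ (filter-none (_∈? S) lefts-outer)
                                                                     (filter-accept (_∈? S) s∈S) ⟩
      s ∷ filter (_∈? S) (rights s)                           ≡⟨ cong (s ∷_) (filter-none (_∈? S) rights-outer) ⟩
      s ∷ []                                                  ∎)
      where open ≡-Reasoning

    roots : List (V D)
    roots = filter (_∈? S) (allFin (n D))

    root∈S : ∀ {s} → s L.∈ roots → s ∈ S
    root∈S s∈ = proj₂ (∈-filter⁻ (_∈? S) {xs = allFin (n D)} s∈)

    partition : ∃ λ P → IsSPathPartitionIn D X S P
    partition = map path roots ,
      ( All.map⁺ (All.tabulate (path-isPath ∘ root∈S))
      , Unique.concat⁺ (All.map⁺ (All.tabulate (proj₁ ∘ proj₂ ∘ path-isPath ∘ root∈S)))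
          (AllPairs.map⁺ (unique⇒AllPairs (Unique.filter⁺ (_∈? S) (Unique.allFin⁺ (n D)))
            λ s∈ t∈ s≢t (v∈s , v∈t) →
              s≢t (home-unique (root∈S s∈) (root∈S t∈) (path⇒home v∈s) (path⇒home v∈t))))
      , λ v → mk⇔ covered inside-X ) ,
      All.map⁺ (All.tabulate (path-count ∘ root∈S))
      where
      covered : ∀ {v} → v ∈ X → v L.∈ concat (map path roots)
      covered v∈X with home-exists v∈X
      ... | s , s∈S , home = ∈-concat⁺′ (home⇒path home) (∈-map⁺ path (∈-filter⁺ (_∈? S) (∈-allFin s) s∈S))
      inside-X : ∀ {v} → v L.∈ concat (map path roots) → v ∈ X
      inside-X v∈ with ∈-concat⁻′ (map path roots) v∈
      ... | p , v∈p , p∈ with ∈-map⁻ path p∈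
      ...   | s , s∈ , refl = home⇒∈X (root∈S s∈) (path⇒home v∈p)

theorem3 : (D : Digraph) → ThreeAntiCirculant D → AlphaDiperfect D
theorem3 D anti X S max = Partition.partition f f-admits f-injective
  where
  anti′ : AntiCirculant (Arc D)
  anti′ v₁≢v₃ v₁≢v₄ v₂≢v₄ e₁ e₂ e₃ = anti _ _ _ _ (arc⇒≢ e₁) v₁≢v₃ v₁≢v₄ (≢-sym (arc⇒≢ e₂)) v₂≢v₄ (arc⇒≢ e₃) e₁ e₂ e₃
    where
    arc⇒≢ : ∀ {u v} → Arc D u v → u ≢ v
    arc⇒≢ {u} e refl with trans (sym e) (loopless D u)
    ... | ()
  open Assignment D anti′ max
  f = proj₁ core-matching
  f-admits = proj₁ (proj₂ core-matching)
  f-injective = proj₂ (proj₂ core-matching)
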